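{- Let $p$ be an odd prime, $n$ a positive integer, $q=p^n$ with $q\equiv1\pmod4$, let $\xi\in\mathbb F_{q^2}\setminus\mathbb F_q$, write $x=x_0+x_1\xi$ ($x_0,x_1\in\mathbb F_q$), and let $\alpha$ be a nonsquare in $\mathbb F_q$. Let $f$ be either $f(x)=(x_0^2+\alpha x_1^{2p^i})+2x_0x_1\xi$ with $0<i<n$, or $f(x)=(x_0^{p^k+1}+\alpha x_1^{p^{k+i}+p^i})+2x_0x_1\xi$ with $0<i,k<n$ and $n/\gcd(k,n)$ odd, and let $\mathcal U_\xi:=\{(x,t\xi):x\in\mathbb F_{q^2},t\in\mathbb F_q\}\cup\{(\infty)\}$, which is a unital in $\Pi(f)$. If there is $\omega\in\mathbb F_q$ with $\omega^2-\omega+1=0$, then $\mathcal U_\xi$ contains an O'Nan configuration.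
   Context: For a planar function $f$ on $\mathbb F_{q^2}$ (i.e.\ $x\mapsto f(x+a)-f(x)$ is bijective for each $a\neq0$; both functions above are planar), $\Pi(f)$ is the projective plane with points $(x,y)\in\mathbb F_{q^2}^2$ and $(a)$ for $a\in\mathbb F_{q^2}\cup\{\infty\}$, lines $L_{a,b}=\{(x,f(x+a)-b):x\in\mathbb F_{q^2}\}\cup\{(a)\}$, $N_a=\{(a,y):y\in\mathbb F_{q^2}\}\cup\{(\infty)\}$ ($a,b\in\mathbb F_{q^2}$), $L_\infty=\{(a):a\in\mathbb F_{q^2}\cup\{\infty\}\}$. A unital is a set of $q^3+1$ points meeting every line in $1$ or $q+1$ points, regarded as a design whose blocks are its intersections with lines meeting it in $q+1$ points. An O'Nan configuration consists of four blocks, any two of which meet, such that the six pairwise intersection points are distinct. -}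

module Defs where

open import Algebra.Bundles using (CommutativeRing)
import Algebra.Properties.Group as GroupProperties
import Algebra.Properties.Ring as RingProperties
import Algebra.Properties.Semiring.Exp as SemiringExp
open import Data.Fin.Base as Fin using (Fin; zero; suc; combine; remQuot)
open import Data.Fin.Properties as Fin using (any?; injective⇒≤; combine-remQuot)
open import Data.Nat.Base as ℕ using (ℕ)
import Data.Nat.Properties as ℕ
open import Data.Product.Base using (Σ; ∃; ∃₂; _×_; _,_; proj₁; proj₂)
open import Function.Bundles using (Bijection)
open import Function.Definitions using (Injective)
open import Level using (Level; _⊔_) renaming (suc to lsuc)
open import Relation.Binary.Bundles using (Setoid)
import Relation.Binary.Construct.On as On
open import Relation.Binary.PropositionalEquality as ≡ using (_≡_; _≢_)
import Relation.Binary.Reasoning.Setoid as SetoidReasoning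
open import Relation.Nullary using (¬_; yes; no; contradiction)
open import Relation.Unary using (Pred; _∈_; _∉_; _∩_; _≐_)

private
  variable
    c ℓ ℓ′ u : Level

HasSize : Setoid c ℓ → ℕ → Set (c ⊔ ℓ)
HasSize S m = Bijection (≡.setoid (Fin m)) S

subsetoid : (S : Setoid c ℓ) → Pred (Setoid.Carrier S) ℓ′ → Setoid (c ⊔ ℓ′) ℓ
subsetoid S P = On.setoid S (proj₁ {B = P})

record IsField (R : CommutativeRing c ℓ) : Set (c ⊔ ℓ) where
  open CommutativeRing R
  field
    0≉1     : 0# ≉ 1#
    inverse : ∀ x → x ≉ 0# → ∃ λ y → x * y ≈ 1#

record IsSubfield (R : CommutativeRing c ℓ)
                  (F : Pred (CommutativeRing.Carrier R) ℓ′) : Set (c ⊔ ℓ ⊔ ℓ′) where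
  open CommutativeRing R
  field
    resp       : ∀ {x y} → x ≈ y → x ∈ F → y ∈ F
    0∈F        : 0# ∈ F
    1∈F        : 1# ∈ F
    +-closed   : ∀ {x y} → x ∈ F → y ∈ F → x + y ∈ F
    neg-closed : ∀ {x} → x ∈ F → - x ∈ F
    *-closed   : ∀ {x y} → x ∈ F → y ∈ F → x * y ∈ F
    inv-closed : ∀ {x y} → x ∈ F → x * y ≈ 1# → y ∈ F

-- The extension 𝔽_{q²} / 𝔽_q, with 𝔽_q given as a subset F of 𝔽_{q²}.
record QuadraticExtension c ℓ ℓ′ (q : ℕ) : Set (lsuc (c ⊔ ℓ ⊔ ℓ′)) where
  field
    commutativeRing : CommutativeRing c ℓ
  open CommutativeRing commutativeRing public
  field
    isField    : IsField commutativeRing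
    size       : HasSize setoid (q ℕ.* q)
    F          : Pred Carrier ℓ′
    isSubfield : IsSubfield commutativeRing F
    F-size     : HasSize (subsetoid setoid F) q

  open IsField isField public
  open IsSubfield isSubfield public

  Nonsquare : Pred Carrier (c ⊔ ℓ ⊔ ℓ′)
  Nonsquare α = α ∈ F × ¬ (∃ λ y → y ∈ F × y * y ≈ α)

module _ {m : ℕ} {g : Fin m → Fin m} (g-injective : Injective _≡_ _≡_ g) where

  injective⇒hits : ∀ y → ∃ λ i → g i ≡ y
  injective⇒hits y with any? (λ i → g i Fin.≟ y)
  ... | yes hit = hit
  ... | no miss = contradiction (injective⇒≤ h-injective) ℕ.1+n≰n
    where
    h : Fin (ℕ.suc m) → Fin m
    h zero    = y
    h (suc i) = g i

    h-injective : Injective _≡_ _≡_ h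
    h-injective {zero}  {zero}  _  = ≡.refl
    h-injective {zero}  {suc j} eq = contradiction (j , ≡.sym eq) miss
    h-injective {suc i} {zero}  eq = contradiction (i , eq) miss
    h-injective {suc i} {suc j} eq = ≡.cong suc (g-injective eq)

module _ {q : ℕ} (E : QuadraticExtension c ℓ ℓ′ q) where
  open QuadraticExtension E
  private
    module K  = Bijection size
    module F′ = Bijection F-size

  module Coordinates (ξ : Carrier) (ξ∉F : ξ ∉ F) where
    open RingProperties ring using ([y-z]x≈yx-zx; +-cancelʳ)
    open GroupProperties +-group using (x∙y⁻¹≈ε⇒x≈y)
    open SetoidReasoning setoid

    private
      elt : Fin q → Carrier
      elt i = proj₁ (F′.to i)

      comb : Fin q → Fin q → Carrier
      comb i j = elt i + elt j * ξ

      slope : ∀ {a b a′ b′} → a + b * ξ ≈ a′ + b′ * ξ → (b - b′) * ξ ≈ - a + a′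
      slope {a} {b} {a′} {b′} eq = begin
        (b - b′) * ξ                     ≈⟨ [y-z]x≈yx-zx ξ b b′ ⟩
        b * ξ - b′ * ξ                   ≈⟨ +-congʳ (+-identityˡ _) ⟨
        (0# + b * ξ) - b′ * ξ            ≈⟨ +-congʳ (+-congʳ (-‿inverseˡ a)) ⟨
        ((- a + a) + b * ξ) - b′ * ξ     ≈⟨ +-congʳ (+-assoc _ _ _) ⟩
        (- a + (a + b * ξ)) - b′ * ξ     ≈⟨ +-congʳ (+-congˡ eq) ⟩
        (- a + (a′ + b′ * ξ)) - b′ * ξ   ≈⟨ +-congʳ (+-assoc _ _ _) ⟨
        ((- a + a′) + b′ * ξ) - b′ * ξ   ≈⟨ +-assoc _ _ _ ⟩
        (- a + a′) + (b′ * ξ - b′ * ξ)   ≈⟨ +-congˡ (-‿inverseʳ _) ⟩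
        (- a + a′) + 0#                  ≈⟨ +-identityʳ _ ⟩
        - a + a′                         ∎

      comb-injectiveʳ : ∀ i j i′ j′ → comb i j ≈ comb i′ j′ → j ≡ j′
      comb-injectiveʳ i j i′ j′ eq with j Fin.≟ j′
      ... | yes j≡j′ = j≡j′
      ... | no  j≢j′ = contradiction ξ∈F ξ∉F
        where
        d = elt j - elt j′

        d≉0 : d ≉ 0#
        d≉0 d≈0 = j≢j′ (F′.injective (x∙y⁻¹≈ε⇒x≈y _ _ d≈0))

        e = proj₁ (inverse d d≉0)

        e∈F : e ∈ F
        e∈F = inv-closed
          (+-closed (proj₂ (F′.to j)) (neg-closed (proj₂ (F′.to j′))))
          (proj₂ (inverse d d≉0))

        ξ∈F : ξ ∈ F
        ξ∈F = resp
          (begin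
            e * (- elt i + elt i′) ≈⟨ *-congˡ (slope eq) ⟨
            e * (d * ξ)            ≈⟨ *-assoc _ _ _ ⟨
            (e * d) * ξ            ≈⟨ *-congʳ (*-comm _ _) ⟩
            (d * e) * ξ            ≈⟨ *-congʳ (proj₂ (inverse d d≉0)) ⟩
            1# * ξ                 ≈⟨ *-identityˡ _ ⟩
            ξ                      ∎)
          (*-closed e∈F
            (+-closed (neg-closed (proj₂ (F′.to i))) (proj₂ (F′.to i′))))

      comb-injective : ∀ i j i′ j′ → comb i j ≈ comb i′ j′ → i ≡ i′ × j ≡ j′
      comb-injective i j i′ j′ eq with comb-injectiveʳ i j i′ j′ eq
      ... | ≡.refl = F′.injective (+-cancelʳ _ _ _ eq) , ≡.refl

      pair : Fin (q ℕ.* q) → Fin q × Fin q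
      pair = remQuot q

      value : Fin (q ℕ.* q) → Carrier
      value k = comb (proj₁ (pair k)) (proj₂ (pair k))

      index : Carrier → Fin (q ℕ.* q)
      index x = proj₁ (K.surjective x)

      to-index : ∀ x → K.to (index x) ≈ x
      to-index x = proj₂ (K.surjective x) ≡.refl

      value-injective : ∀ {k l} → value k ≈ value l → k ≡ l
      value-injective {k} {l} eq
        with i≡ , j≡ ← comb-injective _ _ _ _ eq =
        ≡.trans (≡.sym (combine-remQuot {q} q k))
          (≡.trans (≡.cong₂ combine i≡ j≡) (combine-remQuot {q} q l))

      index∘value-injective : Injective _≡_ _≡_ (λ k → index (value k))
      index∘value-injective eq = value-injective
        (trans (sym (to-index _)) (trans (K.cong eq) (to-index _)))

    -- (x₀ , x₁) ↦ x₀ + x₁ ξ is injective because ξ ∉ F, hence onto by counting.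
    decompose : ∀ x → ∃₂ λ x₀ x₁ → x₀ ∈ F × x₁ ∈ F × x ≈ x₀ + x₁ * ξ
    decompose x with k , eq ← injective⇒hits index∘value-injective (index x) =
      _ , _ , proj₂ (F′.to _) , proj₂ (F′.to _) ,
      trans (sym (to-index x)) (trans (K.cong (≡.sym eq)) (to-index (value k)))

    coord₀ coord₁ : Carrier → Carrier
    coord₀ x = proj₁ (decompose x)
    coord₁ x = proj₁ (proj₂ (decompose x))

  module Functions (p : ℕ) (ξ : Carrier) (ξ∉F : ξ ∉ F) (α : Carrier) where
    open SemiringExp semiring using (_^_)
    open Coordinates ξ ξ∉F

    f₁ : (i : ℕ) → Carrier → Carrier
    f₁ i x = (x₀ ^ 2 + α * x₁ ^ (2 ℕ.* p ℕ.^ i)) + (1# + 1#) * x₀ * x₁ * ξ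
      where
      x₀ = coord₀ x
      x₁ = coord₁ x

    f₂ : (k i : ℕ) → Carrier → Carrier
    f₂ k i x =
      (x₀ ^ (p ℕ.^ k ℕ.+ 1) + α * x₁ ^ (p ℕ.^ (k ℕ.+ i) ℕ.+ p ℕ.^ i))
        + (1# + 1#) * x₀ * x₁ * ξ
      where
      x₀ = coord₀ x
      x₁ = coord₁ x

module Plane (R : CommutativeRing c ℓ)
             (f : CommutativeRing.Carrier R → CommutativeRing.Carrier R) where
  open CommutativeRing R

  data Point : Set c where
    aff : (x y : Carrier) → Point
    dir : (a : Carrier) → Point
    ∞   : Point

  data _≈ₚ_ : Point → Point → Set (c ⊔ ℓ) where
    aff : ∀ {x y x′ y′} → x ≈ x′ → y ≈ y′ → aff x y ≈ₚ aff x′ y′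
    dir : ∀ {a a′} → a ≈ a′ → dir a ≈ₚ dir a′
    ∞   : ∞ ≈ₚ ∞

  pointSetoid : Setoid c (c ⊔ ℓ)
  pointSetoid = record
    { Carrier       = Point
    ; _≈_           = _≈ₚ_
    ; isEquivalence = record { refl = reflₚ ; sym = symₚ ; trans = transₚ }
    }
    where
    reflₚ : ∀ {P} → P ≈ₚ P
    reflₚ {aff x y} = aff refl refl
    reflₚ {dir a}   = dir refl
    reflₚ {∞}       = ∞

    symₚ : ∀ {P Q} → P ≈ₚ Q → Q ≈ₚ P
    symₚ (aff x≈ y≈) = aff (sym x≈) (sym y≈)
    symₚ (dir a≈)    = dir (sym a≈)
    symₚ ∞           = ∞

    transₚ : ∀ {P Q S} → P ≈ₚ Q → Q ≈ₚ S → P ≈ₚ S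
    transₚ (aff x≈ y≈) (aff x≈′ y≈′) = aff (trans x≈ x≈′) (trans y≈ y≈′)
    transₚ (dir a≈)    (dir a≈′)     = dir (trans a≈ a≈′)
    transₚ ∞           ∞             = ∞

  data Line : Set c where
    L  : (a b : Carrier) → Line
    N  : (a : Carrier) → Line
    L∞ : Line

  data pointsOf : Line → Pred Point (c ⊔ ℓ) where
    aff∈L  : ∀ {a b x y} → y ≈ f (x + a) - b → aff x y ∈ pointsOf (L a b)
    dir∈L  : ∀ {a b a′} → a′ ≈ a → dir a′ ∈ pointsOf (L a b)
    aff∈N  : ∀ {a x y} → x ≈ a → aff x y ∈ pointsOf (N a)
    ∞∈N    : ∀ {a} → ∞ ∈ pointsOf (N a)
    dir∈L∞ : ∀ {a} → dir a ∈ pointsOf L∞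
    ∞∈L∞   : ∞ ∈ pointsOf L∞

  -- An O'Nan configuration in the design on U whose blocks are the intersections
  -- of U with the lines meeting it in q + 1 points. In a projective plane two
  -- distinct blocks share at most one point, so meet is the intersection point.
  record ONanConfiguration (q : ℕ) (U : Pred Point u) : Set (c ⊔ ℓ ⊔ u) where
    field
      line : Fin 4 → Line

    block : Fin 4 → Pred Point (c ⊔ ℓ ⊔ u)
    block i = U ∩ pointsOf (line i)

    field
      block-size      : ∀ i → HasSize (subsetoid pointSetoid (block i)) (q ℕ.+ 1)
      blocks-distinct : ∀ {i j} → i ≢ j → ¬ (block i ≐ block j)
      meet            : ∀ {i j} → i Fin.< j → Point
      meet∈           : ∀ {i j} (i<j : i Fin.< j) → meet i<j ∈ block i ∩ block j
      meet-distinct   : ∀ {i j k l} (i<j : i Fin.< j) (k<l : k Fin.< l) →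
                        meet i<j ≈ₚ meet k<l → i ≡ k × j ≡ l

module _ {q : ℕ} (E : QuadraticExtension c ℓ ℓ′ q) where
  open QuadraticExtension E

  module Unital (f : Carrier → Carrier) (ξ : Carrier) where
    open Plane commutativeRing f

    data 𝒰 : Pred Point (c ⊔ ℓ ⊔ ℓ′) where
      aff∈𝒰 : ∀ {x y} t → t ∈ F → y ≈ t * ξ → aff x y ∈ 𝒰
      ∞∈𝒰   : ∞ ∈ 𝒰

    ContainsONan : Set (c ⊔ ℓ ⊔ ℓ′)
    ContainsONan = ONanConfiguration q 𝒰

{-# OPTIONS --safe #-}
-- Write f = g + h ξ with g x = A x₀ ² + α B x₁ ² and h x = 2 x₀ x₁, where A and B are power
-- maps permuting 𝔽_q. As - α is a nonsquare, the conic u² + α v² = r has q + 1 points for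
-- r ≠ 0, so L a b is a block whenever the 𝔽_q-coordinate of b is nonzero. If g takes the
-- same value r at four points c i, then (c i + c j , (h (c i) + h (c j)) ξ) lies on
-- L (- c i) (r - h (c i) ξ), because f ((c i + c j) - c i) = r + h (c j) ξ; by symmetry
-- it lies on the j-th line as well. For the c i = ± 1 ± ξ these six points are distinct.
module Submission where

open import Defs
open import Algebra.Bundles using (CommutativeRing)
import Algebra.Properties.AbelianGroup as AbelianGroupProperties
import Algebra.Properties.CommutativeMonoid.Sum as CommutativeMonoidSum
import Algebra.Properties.CommutativeSemiring.Exp as CommutativeSemiringExp
import Algebra.Properties.Group as GroupProperties
import Algebra.Properties.Ring as RingProperties
import Algebra.Properties.Semiring.Exp as SemiringExp
import Algebra.Properties.Semiring.Mult.TCOptimised as SemiringMult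
import Algebra.Solver.Ring
open import Algebra.Solver.Ring.AlmostCommutativeRing
  using (_-Raw-AlmostCommutative⟶_; fromCommutativeRing)
open import Data.Fin.Base as Fin using (Fin; zero; suc; punchIn; punchOut; inject≤)
open import Data.Fin.Patterns using (0F; 1F; 2F; 3F)
open import Data.Fin.Permutation using (Permutation; permutation)
import Data.Fin.Properties as Fin
open import Data.Integer.Base as ℤ using (ℤ; -[1+_]; 1ℤ; -1ℤ)
import Data.Integer.Divisibility.Signed as ℤ
import Data.Integer.Properties as ℤ
open import Data.Integer.Tactic.RingSolver using (solve-∀)
import Data.Maybe.Base as Maybe
open import Data.Nat.Base as ℕ using (ℕ; zero; suc)
open import Data.Nat.Divisibility using (_∣_; divides; quotient; ∣1⇒≡1)
open import Data.Nat.DivMod using (_divMod_; result; m≡m%n+[m/n]*n)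
open import Data.Nat.GCD using (gcd; gcd[m,n]∣m; gcd[m,n]∣n)
open import Data.Nat.Primality
  using (Prime; prime[2]; euclidsLemma; prime⇒irreducible)
import Data.Nat.Properties as ℕ
open import Data.Nat.Solver using (module +-*-Solver)
open import Data.Product.Base using (∃; ∃₂; _×_; _,_; proj₁; proj₂)
open import Data.Product.Relation.Binary.Pointwise.NonDependent using (×-setoid)
open import Data.Sum.Base using (_⊎_; [_,_]′)
open import Function.Base using (_∘_)
open import Function.Bundles using (Bijection)
open import Function.Definitions using (Injective)
open import Level using (Level; _⊔_)
open import Relation.Binary.Bundles using (Setoid)
open import Relation.Binary.Definitions using (Decidable)
open import Relation.Binary.PropositionalEquality as ≡ using (_≡_; _≢_)
import Relation.Binary.Reasoning.Setoid as SetoidReasoning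
open import Relation.Nullary using (¬_; ¬?; Dec; yes; no; contradiction)
open import Relation.Nullary.Decidable
  using (dec⇒maybe; decidable-stable; from-yes; map′; _⊎-dec_; _×-dec_; _→-dec_)
open import Relation.Unary using (Pred; _∈_; _∉_; _∩_; _≐_)

-- The sign condition comes from `q ≡ 1` modulo 4: `- 1#` is then a square in `F`, so `- α` is a
-- nonsquare along with `α`, and `u² + α v²` has no nontrivial zero.
--
-- The delicate point is that the power maps permute `F`. For `f₁` they are the identity and a power
-- of Frobenius. For `f₂` they are built from `x ^ m` with `m = (p ^ k + 1) / 2`, whose kernel must
-- be shown trivial. If `z ^ m ≈ 1#`, then raising to the power `p ^ k` inverts `z`; since
-- `n / gcd k n` is odd, an odd number of repetitions is the identity of `F`, so `z² ≈ 1#`. The same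
-- argument applied to a square root of `- 1#` shows that `m` is odd, whence `z ≈ 1#`.
--
-- The points `± 1 ± ξ` suit both families because `g` is even in each coordinate and equals `1 + α`
-- there whatever the exponents. Their coordinates are integers that do not depend on the field, so
-- the required inequalities can be decided once over the integers; they survive in the field
-- because the relevant differences divide 8, which is nonzero there.

private
  variable
    c c₁ c₂ ℓ ℓ₁ ℓ₂ ℓ′ : Level

-- Integer constants in a commutative ring, and a ring solver that knows them.

module IntegerCoefficients (R : CommutativeRing c ℓ) where
  open CommutativeRing R hiding (zero)
  open RingProperties ring
    using (-0#≈0#; -‿involutive; -‿distribˡ-*; -‿distribʳ-*)
  open AbelianGroupProperties +-abelianGroup using (⁻¹-∙-comm)
  open SemiringMult semiring renaming (_×_ to _·_)
  open SetoidReasoning setoid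

  -- With this version of multiples, `ι (+ 1)` and `ι (+ 2)` compute to `1#` and `1# + 1#`, the
  -- forms in which these constants occur in the equations given to the solver.
  ι : ℤ → Carrier
  ι (ℤ.+ n)  = n · 1#
  ι -[1+ n ] = - (suc n · 1#)

  ι-neg : ∀ i → ι (ℤ.- i) ≈ - ι i
  ι-neg (ℤ.+ zero)  = sym -0#≈0#
  ι-neg (ℤ.+ suc n) = refl
  ι-neg -[1+ n ]    = sym (-‿involutive _)

  private
    +-cancel : ∀ a x y → x - y ≈ (a + x) - (a + y)
    +-cancel a x y = begin
      x - y                   ≈⟨ +-identityˡ _ ⟨
      0# + (x - y)            ≈⟨ +-congʳ (-‿inverseʳ a) ⟨
      (a - a) + (x - y)       ≈⟨ +-assoc _ _ _ ⟩
      a + (- a + (x - y))     ≈⟨ +-congˡ (+-assoc _ _ _) ⟨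
      a + ((- a + x) - y)     ≈⟨ +-congˡ (+-congʳ (+-comm _ _)) ⟩
      a + ((x - a) - y)       ≈⟨ +-congˡ (+-assoc _ _ _) ⟩
      a + (x + (- a - y))     ≈⟨ +-assoc _ _ _ ⟨
      (a + x) + (- a - y)     ≈⟨ +-congˡ (⁻¹-∙-comm a y) ⟩
      (a + x) - (a + y)       ∎

  ι-⊖ : ∀ m n → ι (m ℤ.⊖ n) ≈ m · 1# - n · 1#
  ι-⊖ m       zero    = sym (trans (+-congˡ -0#≈0#) (+-identityʳ _))
  ι-⊖ zero    (suc n) = sym (+-identityˡ _)
  ι-⊖ (suc m) (suc n) = begin
    ι (suc m ℤ.⊖ suc n)                 ≡⟨ ≡.cong ι (ℤ.[1+m]⊖[1+n]≡m⊖n m n) ⟩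
    ι (m ℤ.⊖ n)                         ≈⟨ ι-⊖ m n ⟩
    m · 1# - n · 1#                     ≈⟨ +-cancel 1# _ _ ⟩
    (1# + m · 1#) - (1# + n · 1#)       ≈⟨ +-cong (1+× m 1#) (-‿cong (1+× n 1#)) ⟨
    suc m · 1# - suc n · 1#             ∎

  ι-+ : ∀ i j → ι (i ℤ.+ j) ≈ ι i + ι j
  ι-+ (ℤ.+ m)  (ℤ.+ n)  = ×-homo-+ 1# m n
  ι-+ (ℤ.+ m)  -[1+ n ] = ι-⊖ m (suc n)
  ι-+ -[1+ m ] (ℤ.+ n)  = trans (ι-⊖ n (suc m)) (+-comm _ _)
  ι-+ -[1+ m ] -[1+ n ] = begin
    - (suc (suc (m ℕ.+ n)) · 1#)        ≈⟨ -‿cong (1+× (suc (m ℕ.+ n)) 1#) ⟩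
    - (1# + (suc m ℕ.+ n) · 1#)         ≈⟨ -‿cong (+-congˡ (×-homo-+ 1# (suc m) n)) ⟩
    - (1# + (suc m · 1# + n · 1#))      ≈⟨ -‿cong (+-assoc _ _ _) ⟨
    - ((1# + suc m · 1#) + n · 1#)      ≈⟨ -‿cong (+-congʳ (+-comm _ _)) ⟩
    - ((suc m · 1# + 1#) + n · 1#)      ≈⟨ -‿cong (+-assoc _ _ _) ⟩
    - (suc m · 1# + (1# + n · 1#))      ≈⟨ -‿cong (+-congˡ (1+× n 1#)) ⟨
    - (suc m · 1# + suc n · 1#)         ≈⟨ ⁻¹-∙-comm _ _ ⟨
    - (suc m · 1#) - (suc n · 1#)       ∎

  private
    ι-*⁺⁺ : ∀ m n → ι (ℤ.+ m ℤ.* ℤ.+ n) ≈ ι (ℤ.+ m) * ι (ℤ.+ n)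
    ι-*⁺⁺ m n = trans (reflexive (≡.cong ι (≡.sym (ℤ.pos-* m n)))) (×1-homo-* m n)

    ι-*⁺ : ∀ m j → ι (ℤ.+ m ℤ.* j) ≈ ι (ℤ.+ m) * ι j
    ι-*⁺ m (ℤ.+ n)  = ι-*⁺⁺ m n
    ι-*⁺ m -[1+ n ] = begin
      ι (ℤ.+ m ℤ.* -[1+ n ])            ≡⟨ ≡.cong ι (ℤ.neg-distribʳ-* (ℤ.+ m) (ℤ.+ suc n)) ⟨
      ι (ℤ.- (ℤ.+ m ℤ.* ℤ.+ suc n))     ≈⟨ ι-neg (ℤ.+ m ℤ.* ℤ.+ suc n) ⟩
      - ι (ℤ.+ m ℤ.* ℤ.+ suc n)         ≈⟨ -‿cong (ι-*⁺⁺ m (suc n)) ⟩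
      - (ι (ℤ.+ m) * ι (ℤ.+ suc n))     ≈⟨ -‿distribʳ-* _ _ ⟩
      ι (ℤ.+ m) * ι -[1+ n ]            ∎

  ι-* : ∀ i j → ι (i ℤ.* j) ≈ ι i * ι j
  ι-* (ℤ.+ m)  j = ι-*⁺ m j
  ι-* -[1+ m ] j = begin
    ι (-[1+ m ] ℤ.* j)                  ≡⟨ ≡.cong ι (ℤ.neg-distribˡ-* (ℤ.+ suc m) j) ⟨
    ι (ℤ.- (ℤ.+ suc m ℤ.* j))           ≈⟨ ι-neg (ℤ.+ suc m ℤ.* j) ⟩
    - ι (ℤ.+ suc m ℤ.* j)               ≈⟨ -‿cong (ι-*⁺ (suc m) j) ⟩
    - (ι (ℤ.+ suc m) * ι j)             ≈⟨ -‿distribˡ-* _ _ ⟩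
    ι -[1+ m ] * ι j                    ∎

  private
    ι-homomorphism :
      ℤ.+-*-rawRing -Raw-AlmostCommutative⟶ fromCommutativeRing R
    ι-homomorphism = record
      { ⟦_⟧    = ι
      ; +-homo = ι-+
      ; *-homo = ι-*
      ; -‿homo = ι-neg
      ; 0-homo = refl
      ; 1-homo = refl
      }

  -- Coefficients are compared in the integers, where equality is decidable, so cancellation works
  -- even though equality in `R` is not decided.
  module Solver = Algebra.Solver.Ring ℤ.+-*-rawRing (fromCommutativeRing R)
    ι-homomorphism
    (λ i j → Maybe.map (λ i≡j → reflexive (≡.cong ι i≡j)) (dec⇒maybe (i ℤ.≟ j)))

-- Cancellation in a field, and the bound on the number of roots of a polynomial.

module FieldProperties (R : CommutativeRing c ℓ) (isField : IsField R) where
  open CommutativeRing R hiding (zero)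
  open IsField isField
  open GroupProperties +-group public using ()
    renaming (x∙y⁻¹≈ε⇒x≈y to x-y≈0⇒x≈y; x≈y⇒x∙y⁻¹≈ε to x≈y⇒x-y≈0)
  open SemiringExp semiring using (_^_)
  open SetoidReasoning setoid
  open IntegerCoefficients R
  open Solver using (solve; _:=_; _:+_; _:*_; _:-_)

  x*y≈0⇒y≈0 : ∀ {x y} → x ≉ 0# → x * y ≈ 0# → y ≈ 0#
  x*y≈0⇒y≈0 {x} {y} x≉0 xy≈0 with z , xz≈1 ← inverse x x≉0 = begin
    y             ≈⟨ *-identityˡ y ⟨
    1# * y        ≈⟨ *-congʳ xz≈1 ⟨
    (x * z) * y   ≈⟨ solve 3 (λ x y z → (x :* z) :* y := z :* (x :* y)) refl x y z ⟩
    z * (x * y)   ≈⟨ *-congˡ xy≈0 ⟩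
    z * 0#        ≈⟨ zeroʳ z ⟩
    0#            ∎

  *-nonzero : ∀ {x y} → x ≉ 0# → y ≉ 0# → x * y ≉ 0#
  *-nonzero x≉0 y≉0 xy≈0 = y≉0 (x*y≈0⇒y≈0 x≉0 xy≈0)

  *-cancelˡ : ∀ {x y z} → x ≉ 0# → x * y ≈ x * z → y ≈ z
  *-cancelˡ {x} {y} {z} x≉0 xy≈xz = x-y≈0⇒x≈y _ _ (x*y≈0⇒y≈0 x≉0 (begin
    x * (y - z)       ≈⟨ solve 3 (λ x y z → x :* (y :- z) := x :* y :- x :* z) refl x y z ⟩
    x * y - x * z     ≈⟨ x≈y⇒x-y≈0 xy≈xz ⟩
    0#                ∎))

  ^-nonzero : ∀ {x} n → x ≉ 0# → x ^ n ≉ 0#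
  ^-nonzero zero    x≉0 1≈0 = 0≉1 (sym 1≈0)
  ^-nonzero (suc n) x≉0     = *-nonzero x≉0 (^-nonzero n x≉0)

  -- g is a polynomial function of degree at most d in which x ^ d has
  -- coefficient l; the witness at r is the quotient of g x - g r by x - r.
  Polynomial : ℕ → Carrier → (Carrier → Carrier) → Set (c ⊔ ℓ)
  Polynomial zero    l g = ∀ x → g x ≈ l
  Polynomial (suc d) l g = ∀ r → ∃ λ h →
    Polynomial d l h × (∀ x → g x - g r ≈ (x - r) * h x)

  polynomial-cong : ∀ d {l l′ g} → l ≈ l′ → Polynomial d l g → Polynomial d l′ g
  polynomial-cong zero    l≈l′ P x = trans (P x) l≈l′
  polynomial-cong (suc d) l≈l′ P r with h , Q , eq ← P r =
    h , polynomial-cong d l≈l′ Q , eq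

  polynomial-raise : ∀ d {l g} → Polynomial d l g → Polynomial (suc d) 0# g
  polynomial-raise zero {g = g} P r = (λ _ → 0#) , (λ _ → refl) , λ x → begin
    g x - g r      ≈⟨ x≈y⇒x-y≈0 (trans (P x) (sym (P r))) ⟩
    0#             ≈⟨ zeroʳ _ ⟨
    (x - r) * 0#   ∎
  polynomial-raise (suc d) P r with h , Q , eq ← P r =
    h , polynomial-raise d Q , eq

  polynomial-+ : ∀ d {l l′ g g′} → Polynomial d l g → Polynomial d l′ g′ →
                 Polynomial d (l + l′) (λ x → g x + g′ x)
  polynomial-+ zero    P P′ x = +-cong (P x) (P′ x)
  polynomial-+ (suc d) {g = g} {g′} P P′ r
    with h , Q , eq ← P r | h′ , Q′ , eq′ ← P′ r =
    (λ x → h x + h′ x) , polynomial-+ d Q Q′ , λ x → begin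
      (g x + g′ x) - (g r + g′ r)
        ≈⟨ solve 4 (λ a b c d → (a :+ b) :- (c :+ d) := (a :- c) :+ (b :- d)) refl _ _ _ _ ⟩
      (g x - g r) + (g′ x - g′ r)
        ≈⟨ +-cong (eq x) (eq′ x) ⟩
      (x - r) * h x + (x - r) * h′ x
        ≈⟨ distribˡ _ _ _ ⟨
      (x - r) * (h x + h′ x) ∎

  polynomial-scale : ∀ d s {l g} → Polynomial d l g →
                     Polynomial d (s * l) (λ x → s * g x)
  polynomial-scale zero    s P x = *-congˡ (P x)
  polynomial-scale (suc d) s {g = g} P r with h , Q , eq ← P r =
    (λ x → s * h x) , polynomial-scale d s Q , λ x → begin
      s * g x - s * g r
        ≈⟨ solve 3 (λ s a b → s :* a :- s :* b := s :* (a :- b)) refl _ _ _ ⟩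
      s * (g x - g r)
        ≈⟨ *-congˡ (eq x) ⟩
      s * ((x - r) * h x)
        ≈⟨ solve 3 (λ s a b → s :* (a :* b) := a :* (s :* b)) refl _ _ _ ⟩
      (x - r) * (s * h x) ∎

  -- The quotient comes from `x * g x - r * g r ≈ (x - r) * g x + r * (g x - g r)`. Its summand `g
  -- x` carries the leading coefficient; the summand from the second term has lower degree.
  polynomial-shift : ∀ d {l g} → Polynomial d l g →
                     Polynomial (suc d) l (λ x → x * g x)
  polynomial-shift zero {l} {g} P r = g , P , λ x → begin
    x * g x - r * g r
      ≈⟨ +-congˡ (-‿cong (*-congˡ (trans (P r) (sym (P x))))) ⟩
    x * g x - r * g x
      ≈⟨ solve 3 (λ x r a → x :* a :- r :* a := (x :- r) :* a) refl _ _ _ ⟩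
    (x - r) * g x ∎
  polynomial-shift (suc d) {l} {g} P r with h , Q , eq ← P r =
    (λ x → g x + r * h x) ,
    polynomial-cong (suc d) (+-identityʳ l)
      (polynomial-+ (suc d) P (polynomial-raise d (polynomial-scale d r Q))) ,
    λ x → begin
      x * g x - r * g r
        ≈⟨ solve 4 (λ x r a b → x :* a :- r :* b := (x :- r) :* a :+ r :* (a :- b))
             refl _ _ _ _ ⟩
      (x - r) * g x + r * (g x - g r)
        ≈⟨ +-congˡ (*-congˡ (eq x)) ⟩
      (x - r) * g x + r * ((x - r) * h x)
        ≈⟨ solve 4 (λ x r a b → (x :- r) :* a :+ r :* ((x :- r) :* b)
                             := (x :- r) :* (a :+ r :* b)) refl _ _ _ _ ⟩
      (x - r) * (g x + r * h x) ∎

  polynomial-^ : ∀ d → Polynomial d 1# (_^ d)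
  polynomial-^ zero    x = refl
  polynomial-^ (suc d)   = polynomial-shift d (polynomial-^ d)

  -- Dividing by `x - z zero` leaves a quotient of one degree less that vanishes at all the other
  -- points. Repeating this ends with the constant `l`, which still vanishes at one point.
  constant⇒leading≈0 : ∀ d {l g k} → Polynomial (suc d) l g →
                       (z : Fin (suc (suc d)) → Carrier) → Injective _≡_ _≈_ z →
                       (∀ i → g (z i) ≈ k) → l ≈ 0#
  constant⇒leading≈0 d {l} {g} P z z-injective const = finish d Q z′-injective h-root
    where
    h = proj₁ (P (z zero))
    Q = proj₁ (proj₂ (P (z zero)))

    z′-injective : Injective _≡_ _≈_ (λ i → z (suc i))
    z′-injective e = Fin.suc-injective (z-injective e)

    h-root : ∀ i → h (z (suc i)) ≈ 0#
    h-root i = x*y≈0⇒y≈0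
      (λ e → Fin.0≢1+n (z-injective (sym (x-y≈0⇒x≈y _ _ e)))) (begin
        (z (suc i) - z zero) * h (z (suc i))
          ≈⟨ proj₂ (proj₂ (P (z zero))) (z (suc i)) ⟨
        g (z (suc i)) - g (z zero)
          ≈⟨ x≈y⇒x-y≈0 (trans (const (suc i)) (sym (const zero))) ⟩
        0# ∎)

    finish : ∀ d {h} {z : Fin (suc d) → Carrier} → Polynomial d l h →
             Injective _≡_ _≈_ z → (∀ i → h (z i) ≈ 0#) → l ≈ 0#
    finish zero    Q _ root = trans (sym (Q _)) (root zero)
    finish (suc d) Q z-injective root = constant⇒leading≈0 d Q _ z-injective root

HasSize-pullback : {S : Setoid c₁ ℓ₁} {T : Setoid c₂ ℓ₂} {m : ℕ} →
                   Bijection S T → HasSize T m → HasSize S m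
HasSize-pullback {S = S} {T} f size = record
  { to        = to
  ; cong      = λ { ≡.refl → S.refl }
  ; bijective =
      (λ eq → Size.injective (T.trans (T.sym (f-to _)) (T.trans (f.cong eq) (f-to _)))) ,
      λ x → proj₁ (Size.surjective (f.to x)) , λ { ≡.refl →
        f.injective (T.trans (f-to _) (proj₂ (Size.surjective (f.to x)) ≡.refl)) }
  }
  where
  module S = Setoid S
  module T = Setoid T
  module f = Bijection f
  module Size = Bijection size

  to = λ i → proj₁ (f.surjective (Size.to i))

  f-to : ∀ i → f.to (to i) T.≈ Size.to i
  f-to i = proj₂ (f.surjective (Size.to i)) S.refl

-- Finiteness of the two fields: decidable equality, and counting in `F`.

module Subfield {q : ℕ} (E : QuadraticExtension c ℓ ℓ′ q) where
  open QuadraticExtension E hiding (zero)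
  open CommutativeSemiringExp commutativeSemiring using (_^_)
  open IntegerCoefficients commutativeRing
  open FieldProperties commutativeRing isField
  open Solver using (solve; _:=_; _:+_; _:*_; _:-_; con)
  open SetoidReasoning setoid
  private
    module K  = Bijection size
    module F′ = Bijection F-size

  infix 4 _≟_

  _≟_ : Decidable _≈_
  x ≟ y = map′
    (λ eq → trans (sym (to-index x)) (trans (K.cong eq) (to-index y)))
    (λ x≈y → K.injective (trans (to-index x) (trans x≈y (sym (to-index y)))))
    (index x Fin.≟ index y)
    where
    index : Carrier → Fin (q ℕ.* q)
    index x = proj₁ (K.surjective x)

    to-index : ∀ x → K.to (index x) ≈ x
    to-index x = proj₂ (K.surjective x) ≡.refl

  elt : Fin q → Carrier
  elt i = proj₁ (F′.to i)

  elt∈F : ∀ i → elt i ∈ F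
  elt∈F i = proj₂ (F′.to i)

  elt-injective : Injective _≡_ _≈_ elt
  elt-injective = F′.injective

  index : ∀ {x} → x ∈ F → Fin q
  index x∈F = proj₁ (F′.surjective (_ , x∈F))

  elt-index : ∀ {x} (x∈F : x ∈ F) → elt (index x∈F) ≈ x
  elt-index x∈F = proj₂ (F′.surjective (_ , x∈F)) ≡.refl

  InjectiveOnF : (Carrier → Carrier) → Set (c ⊔ ℓ ⊔ ℓ′)
  InjectiveOnF g = ∀ {x y} → x ∈ F → y ∈ F → g x ≈ g y → x ≈ y

  injective⇒onto : ∀ {g} → (∀ {x} → x ∈ F → g x ∈ F) → InjectiveOnF g →
                   ∀ {y} → y ∈ F → ∃ λ x → x ∈ F × g x ≈ y
  injective⇒onto {g} g∈F g-injective {y} y∈F = elt i , elt∈F i , (begin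
    g (elt i)          ≈⟨ elt-index _ ⟨
    elt (h i)          ≡⟨ ≡.cong elt (proj₂ hit) ⟩
    elt (index y∈F)    ≈⟨ elt-index y∈F ⟩
    y                  ∎)
    where
    h : Fin q → Fin q
    h i = index (g∈F (elt∈F i))

    h-injective : Injective _≡_ _≡_ h
    h-injective eq = elt-injective (g-injective (elt∈F _) (elt∈F _)
      (trans (sym (elt-index _)) (trans (reflexive (≡.cong elt eq)) (elt-index _))))

    hit = injective⇒hits h-injective (index y∈F)
    i = proj₁ hit

  -‿closed : ∀ {x y} → x ∈ F → y ∈ F → x - y ∈ F
  -‿closed x∈F y∈F = +-closed x∈F (neg-closed y∈F)

  ^-closed : ∀ {x} n → x ∈ F → x ^ n ∈ F
  ^-closed zero    x∈F = 1∈F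
  ^-closed (suc n) x∈F = *-closed x∈F (^-closed n x∈F)

  ι∈F : ∀ i → ι i ∈ F
  ι∈F (ℤ.+ n) = ι⁺∈F n
    where
    ι⁺∈F : ∀ n → ι (ℤ.+ n) ∈ F
    ι⁺∈F 0             = 0∈F
    ι⁺∈F 1             = 1∈F
    ι⁺∈F (suc (suc n)) = +-closed (ι⁺∈F (suc n)) 1∈F
  ι∈F -[1+ n ] = neg-closed (ι∈F (ℤ.+ suc n))

  -- In characteristic 2 squaring is injective, hence onto F.
  nonsquare⇒2≉0 : ∀ {α} → Nonsquare α → 1# + 1# ≉ 0#
  nonsquare⇒2≉0 (α∈F , α-nonsquare) 2≈0 =
    α-nonsquare (injective⇒onto (λ x∈F → *-closed x∈F x∈F) (λ _ _ → square-injective) α∈F)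
    where
    square-injective : ∀ {x y} → x * x ≈ y * y → x ≈ y
    square-injective {x} {y} eq with x - y ≟ 0#
    ... | yes x-y≈0 = x-y≈0⇒x≈y _ _ x-y≈0
    ... | no  x-y≉0 = contradiction (begin
      (x - y) * (x - y)
        ≈⟨ solve 2 (λ x y → (x :- y) :* (x :- y)
             := (x :* x :- y :* y) :+ con (ℤ.+ 2) :* (y :* y :- x :* y)) refl x y ⟩
      (x * x - y * y) + (1# + 1#) * (y * y - x * y)
        ≈⟨ +-cong (x≈y⇒x-y≈0 eq) (trans (*-congʳ 2≈0) (zeroˡ _)) ⟩
      0# + 0#
        ≈⟨ +-identityʳ 0# ⟩
      0# ∎) (*-nonzero x-y≉0 x-y≉0)

-- The units of `F`; the order of `F` is `suc q`, so that `q` counts them.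

module Units {q : ℕ} (E : QuadraticExtension c ℓ ℓ′ (suc q)) where
  open QuadraticExtension E hiding (zero)
  open CommutativeSemiringExp commutativeSemiring
    using (_^_; ^-congʳ; ^-assocʳ)
  open CommutativeMonoidSum *-commutativeMonoid
    using () renaming (sum to ∏; sum-permute to ∏-permute; ∑-distrib-+ to ∏-distrib-*;
                       sum-cong-≋ to ∏-cong; sum-replicate to ∏-replicate)
  open IntegerCoefficients commutativeRing
  open FieldProperties commutativeRing isField
  open Solver using (solve; _:=_; _:*_; _:-_; :-_; con)
  open SetoidReasoning setoid
  open Subfield E

  private
    0-index : Fin (suc q)
    0-index = index 0∈F

  unit : Fin q → Carrier
  unit j = elt (punchIn 0-index j)

  unit∈F : ∀ j → unit j ∈ F
  unit∈F j = elt∈F _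

  unit≉0 : ∀ j → unit j ≉ 0#
  unit≉0 j eq = Fin.punchInᵢ≢i 0-index j
    (elt-injective (trans eq (sym (elt-index 0∈F))))

  unit-injective : Injective _≡_ _≈_ unit
  unit-injective eq = Fin.punchIn-injective 0-index _ _ (elt-injective eq)

  unit-onto : ∀ {x} → x ∈ F → x ≉ 0# → ∃ λ j → unit j ≈ x
  unit-onto {x} x∈F x≉0 = punchOut 0≢i ,
    trans (reflexive (≡.cong elt (Fin.punchIn-punchOut 0≢i))) (elt-index x∈F)
    where
    0≢i : 0-index ≢ index x∈F
    0≢i eq = x≉0 (begin
      x                  ≈⟨ elt-index x∈F ⟨
      elt (index x∈F)    ≡⟨ ≡.cong elt eq ⟨
      elt 0-index        ≈⟨ elt-index 0∈F ⟩
      0#                 ∎)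

  ∏-nonzero : ∀ {n} {g : Fin n → Carrier} → (∀ i → g i ≉ 0#) → ∏ g ≉ 0#
  ∏-nonzero {zero}  _   1≈0 = 0≉1 (sym 1≈0)
  ∏-nonzero {suc n} g≉0     = *-nonzero (g≉0 zero) (∏-nonzero (λ i → g≉0 (suc i)))

  -- Multiplication by x permutes the units, which multiplies their product by x ^ q.
  fermat : ∀ {x} → x ∈ F → x ≉ 0# → x ^ q ≈ 1#
  fermat {x} x∈F x≉0 = sym (*-cancelˡ (∏-nonzero unit≉0) (begin
    ∏ unit * 1#                        ≈⟨ *-identityʳ _ ⟩
    ∏ unit                             ≈⟨ ∏-permute unit π ⟩
    ∏ (λ j → unit (σ j))               ≈⟨ ∏-cong unit-σ ⟩
    ∏ (λ j → x * unit j)               ≈⟨ ∏-distrib-* (λ _ → x) unit ⟩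
    ∏ {q} (λ _ → x) * ∏ unit           ≈⟨ *-congʳ (∏-replicate q) ⟩
    x ^ q * ∏ unit                     ≈⟨ *-comm _ _ ⟩
    ∏ unit * x ^ q                     ∎))
    where
    shifted : ∀ j → ∃ λ k → unit k ≈ x * unit j
    shifted j = unit-onto (*-closed x∈F (unit∈F j)) (*-nonzero x≉0 (unit≉0 j))

    σ : Fin q → Fin q
    σ j = proj₁ (shifted j)

    unit-σ : ∀ j → unit (σ j) ≈ x * unit j
    unit-σ j = proj₂ (shifted j)

    σ-injective : Injective _≡_ _≡_ σ
    σ-injective {j} {k} eq = unit-injective (*-cancelˡ x≉0 (begin
      x * unit j      ≈⟨ unit-σ j ⟨
      unit (σ j)      ≡⟨ ≡.cong unit eq ⟩
      unit (σ k)      ≈⟨ unit-σ k ⟩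
      x * unit k      ∎))

    σ⁻¹ : Fin q → Fin q
    σ⁻¹ k = proj₁ (injective⇒hits σ-injective k)

    σ-σ⁻¹ : ∀ k → σ (σ⁻¹ k) ≡ k
    σ-σ⁻¹ k = proj₂ (injective⇒hits σ-injective k)

    π : Permutation q q
    π = permutation σ σ⁻¹ σ-σ⁻¹ (λ j → σ-injective (σ-σ⁻¹ (σ j)))

  x^∣F∣≈x : ∀ {x} → x ∈ F → x ^ suc q ≈ x
  x^∣F∣≈x {x} x∈F with x ≟ 0#
  ... | yes x≈0 = begin
    x * x ^ q    ≈⟨ *-congʳ x≈0 ⟩
    0# * x ^ q   ≈⟨ zeroˡ _ ⟩
    0#           ≈⟨ x≈0 ⟨
    x            ∎
  ... | no  x≉0 = trans (*-congˡ (fermat x∈F x≉0)) (*-identityʳ x)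

  -- x ^ (2 m) takes the value 1# at most 2 m times, but there are 4 m units.
  some-power≉1 : ∀ m → q ≡ m ℕ.* 4 → ¬ (∀ j → unit j ^ (m ℕ.* 2) ≈ 1#)
  -- Here there would be no units at all, but `1#` is one.
  some-power≉1 zero    q≡0  _   = Fin.¬Fin0
    (≡.subst Fin q≡0 (proj₁ (unit-onto 1∈F (λ 1≈0 → 0≉1 (sym 1≈0)))))
  some-power≉1 (suc m) q≡4m all = 0≉1 (sym
    (constant⇒leading≈0 (suc (m ℕ.* 2)) (polynomial-^ (suc m ℕ.* 2))
      (λ i → unit (inject≤ i bound))
      (λ eq → Fin.inject≤-injective bound bound _ _ (unit-injective eq))
      (λ i → all (inject≤ i bound))))
    where
    -- The polynomial has degree `2 + m * 2`, so one point more than that is needed.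
    bound : 3 ℕ.+ m ℕ.* 2 ℕ.≤ q
    bound = ≡.subst (3 ℕ.+ m ℕ.* 2 ℕ.≤_) (≡.sym q≡4m)
      (ℕ.+-mono-≤ (ℕ.n≤1+n 3) (ℕ.*-monoʳ-≤ m (ℕ.m≤m+n 2 2)))

  -- If x ^ (2 m) ≉ 1#, then x ^ m squares to - 1#.
  √-1 : ∀ m → q ≡ m ℕ.* 4 → ∃ λ y → y ∈ F × y * y ≈ - 1#
  √-1 m q≡4m with Fin.any? (λ j → ¬? (unit j ^ (m ℕ.* 2) ≟ 1#))
  ... | no  none         = contradiction
    (λ j → decidable-stable (_ ≟ _) (λ ≉1 → none (j , ≉1))) (some-power≉1 m q≡4m)
  ... | yes (j , x^2m≉1) = y , ^-closed m (unit∈F j) , x-y≈0⇒x≈y _ _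
    (x*y≈0⇒y≈0 (λ e → x^2m≉1 (trans y² (x-y≈0⇒x≈y _ _ e))) (begin
      (y * y - 1#) * (y * y - - 1#)
        ≈⟨ solve 1 (λ y → (y :* y :- con (ℤ.+ 1)) :* (y :* y :- :- con (ℤ.+ 1))
             := y :* (y :* (y :* (y :* con (ℤ.+ 1)))) :- con (ℤ.+ 1)) refl y ⟩
      y ^ 4 - 1#
        ≈⟨ x≈y⇒x-y≈0 (trans (^-assocʳ x m 4) (trans (^-congʳ x (≡.sym q≡4m))
             (fermat (unit∈F j) (unit≉0 j)))) ⟩
      0# ∎))
    where
    x = unit j
    y = x ^ m

    y² : x ^ (m ℕ.* 2) ≈ y * y
    y² = trans (sym (^-assocʳ x m 2)) (*-congˡ (*-identityʳ y))

-- Counting the points of the conic `u² + α v² = r` by projection from one of them.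

module Conic {q : ℕ} (E : QuadraticExtension c ℓ ℓ′ q)
             {α : QuadraticExtension.Carrier E} where
  open QuadraticExtension E hiding (zero)
  open IntegerCoefficients commutativeRing
  open FieldProperties commutativeRing isField
  open Solver using (solve; _:=_; _:+_; _:*_; _:-_; :-_; con)
  open RingProperties ring using (+-cancelˡ)
  open SetoidReasoning setoid
  open Subfield E

  OnConic : Carrier → Pred (Carrier × Carrier) (ℓ ⊔ ℓ′)
  OnConic r (u , v) = u ∈ F × v ∈ F × u * u + α * (v * v) ≈ r

  conicSetoid : Carrier → Setoid (c ⊔ ℓ ⊔ ℓ′) ℓ
  conicSetoid r = subsetoid (×-setoid setoid setoid) (OnConic r)

  -- The lines through (u₀ , v₀) of direction (1# , 0#) and (t , 1#), t ∈ F, each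
  -- meet the conic in one further point, which is (u₀ , v₀) itself for the tangent.
  module _ (α∈F : α ∈ F) (2≉0 : 1# + 1# ≉ 0#)
           (anisotropic : ∀ {t} → t ∈ F → t * t + α ≉ 0#)
           {u₀ v₀ : Carrier} (u₀∈F : u₀ ∈ F) (v₀∈F : v₀ ∈ F) (u₀≉0 : u₀ ≉ 0#) where

    private
      r = u₀ * u₀ + α * (v₀ * v₀)

      -- Substituting `(u₀ + s * t , v₀ + s)` into the equation of the conic and cancelling one
      -- factor `s` leaves `s * (t * t + α) ≈ slope-term t`. Anisotropy makes this solvable for `s`.
      slope-term : Carrier → Carrier
      slope-term t = - ((1# + 1#) * (u₀ * t + α * v₀))

      chord : ∀ {t} → t ∈ F → ∃ λ s → s ∈ F × s * (t * t + α) ≈ slope-term t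
      chord {t} t∈F with z , eq ← inverse _ (anisotropic t∈F) =
        slope-term t * z ,
        *-closed
          (neg-closed (*-closed (+-closed 1∈F 1∈F)
            (+-closed (*-closed u₀∈F t∈F) (*-closed α∈F v₀∈F))))
          (inv-closed (+-closed (*-closed t∈F t∈F) α∈F) eq) ,
        (begin
          (slope-term t * z) * (t * t + α)
            ≈⟨ solve 3 (λ n z w → (n :* z) :* w := n :* (w :* z)) refl _ _ _ ⟩
          slope-term t * ((t * t + α) * z)
            ≈⟨ *-congˡ eq ⟩
          slope-term t * 1#
            ≈⟨ *-identityʳ _ ⟩
          slope-term t ∎)

      s : Fin q → Carrier
      s i = proj₁ (chord (elt∈F i))

      s∈F : ∀ i → s i ∈ F
      s∈F i = proj₁ (proj₂ (chord (elt∈F i)))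

      s-eq : ∀ i → s i * (elt i * elt i + α) ≈ slope-term (elt i)
      s-eq i = proj₂ (proj₂ (chord (elt∈F i)))

      s-unique : ∀ i {w} → w * (elt i * elt i + α) ≈ slope-term (elt i) → s i ≈ w
      s-unique i eq = *-cancelˡ (anisotropic (elt∈F i))
        (trans (*-comm _ _) (trans (trans (s-eq i) (sym eq)) (*-comm _ _)))

      point : Fin (suc q) → Carrier × Carrier
      point zero    = - u₀ , v₀
      point (suc i) = u₀ + s i * elt i , v₀ + s i

      point-onConic : ∀ k → OnConic r (point k)
      point-onConic zero    = neg-closed u₀∈F , v₀∈F , +-congʳ
        (solve 1 (λ u → (:- u) :* (:- u) := u :* u) refl u₀)
      point-onConic (suc i) =
        +-closed u₀∈F (*-closed (s∈F i) (elt∈F i)) , +-closed v₀∈F (s∈F i) , (begin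
          (u₀ + s i * t) * (u₀ + s i * t) + α * ((v₀ + s i) * (v₀ + s i))
            ≈⟨ solve 5 (λ u v α s t →
                 (u :+ s :* t) :* (u :+ s :* t) :+ α :* ((v :+ s) :* (v :+ s))
                 := (u :* u :+ α :* (v :* v))
                    :+ s :* (s :* (t :* t :+ α)
                             :- :- (con (ℤ.+ 2) :* (u :* t :+ α :* v))))
                 refl u₀ v₀ α (s i) t ⟩
          r + s i * (s i * (t * t + α) - slope-term t)
            ≈⟨ +-congˡ (*-congˡ (x≈y⇒x-y≈0 (s-eq i))) ⟩
          r + s i * 0#
            ≈⟨ +-congˡ (zeroʳ _) ⟩
          r + 0#
            ≈⟨ +-identityʳ r ⟩
          r ∎)
        where t = elt i

      -- This pins down the slope of the tangent, as `u₀` is invertible. Hence two different chords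
      -- cannot both return to the base point.
      tangent : ∀ i → s i ≈ 0# → u₀ * elt i ≈ - (α * v₀)
      tangent i s≈0 = x-y≈0⇒x≈y _ _ (x*y≈0⇒y≈0 2≉0 (begin
        (1# + 1#) * (u₀ * elt i - - (α * v₀))
          ≈⟨ solve 3 (λ u t w → con (ℤ.+ 2) :* (u :* t :- :- w)
               := :- :- (con (ℤ.+ 2) :* (u :* t :+ w))) refl u₀ (elt i) (α * v₀) ⟩
        - slope-term (elt i)
          ≈⟨ -‿cong (s-eq i) ⟨
        - (s i * (elt i * elt i + α))
          ≈⟨ -‿cong (trans (*-congʳ s≈0) (zeroˡ _)) ⟩
        - 0#
          ≈⟨ solve 0 (:- con (ℤ.+ 0) := con (ℤ.+ 0)) refl ⟩
        0# ∎))

      0-chord : ∀ i → v₀ + s i ≈ v₀ → s i ≈ 0#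
      0-chord i eq = +-cancelˡ v₀ _ _ (trans eq (sym (+-identityʳ v₀)))

      -- Equal second coordinates force `s i ≈ 0#`, and then the first ones give `- u₀ ≈ u₀`,
      -- impossible as neither `2` nor `u₀` vanishes.
      horizontal≢ : ∀ i → - u₀ ≈ u₀ + s i * elt i → v₀ ≉ v₀ + s i
      horizontal≢ i u≈ v≈ = *-nonzero 2≉0 u₀≉0 (begin
        (1# + 1#) * u₀
          ≈⟨ solve 2 (λ u w → con (ℤ.+ 2) :* u := (u :+ w) :- (:- u) :- w) refl u₀ _ ⟩
        (u₀ + s i * elt i) - - u₀ - s i * elt i
          ≈⟨ +-cong (x≈y⇒x-y≈0 (sym u≈))
               (-‿cong (trans (*-congʳ (0-chord i (sym v≈))) (zeroˡ _))) ⟩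
        0# - 0#
          ≈⟨ -‿inverseʳ 0# ⟩
        0# ∎)

      point-injective : ∀ {k l} → proj₁ (point k) ≈ proj₁ (point l) →
                        proj₂ (point k) ≈ proj₂ (point l) → k ≡ l
      point-injective {zero}  {zero}  _  _  = ≡.refl
      point-injective {zero}  {suc j} u≈ v≈ = contradiction v≈ (horizontal≢ j u≈)
      point-injective {suc i} {zero}  u≈ v≈ = contradiction (sym v≈) (horizontal≢ i (sym u≈))
      point-injective {suc i} {suc j} u≈ v≈ with s i ≟ 0#
      ... | yes s≈0 = ≡.cong suc (elt-injective (*-cancelˡ u₀≉0 (trans
              (tangent i s≈0)
              (sym (tangent j (trans (sym (+-cancelˡ v₀ _ _ v≈)) s≈0))))))
      ... | no  s≉0 = ≡.cong suc (elt-injective (*-cancelˡ s≉0 (begin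
              s i * elt i    ≈⟨ +-cancelˡ u₀ _ _ u≈ ⟩
              s j * elt j    ≈⟨ *-congʳ (+-cancelˡ v₀ _ _ v≈) ⟨
              s i * elt j    ∎)))

      hit : ∀ {u v t w} → t ∈ F → u ≈ u₀ + w * t → v ≈ v₀ + w →
            w * (t * t + α) ≈ slope-term t →
            ∃ λ k → proj₁ (point k) ≈ u × proj₂ (point k) ≈ v
      hit {t = t} {w} t∈F u≈ v≈ eq = suc i ,
        trans (+-congˡ (*-cong s≈w e)) (sym u≈) , trans (+-congˡ s≈w) (sym v≈)
        where
        i = index t∈F
        e = elt-index t∈F
        s≈w : s i ≈ w
        s≈w = s-unique i (begin
          w * (elt i * elt i + α)   ≈⟨ *-congˡ (+-congʳ (*-cong e e)) ⟩
          w * (t * t + α)           ≈⟨ eq ⟩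
          slope-term t              ≈⟨ -‿cong (*-congˡ (+-congʳ (*-congˡ e))) ⟨
          slope-term (elt i)        ∎)

      point-onto : ∀ {u v} → OnConic r (u , v) →
                   ∃ λ k → proj₁ (point k) ≈ u × proj₂ (point k) ≈ v
      point-onto {u} {v} (u∈F , v∈F , eq) with v - v₀ ≟ 0# | u - u₀ ≟ 0#
      ... | no w≉0 | _ with z , wz≈1 ← inverse _ w≉0 =
        hit t∈F (sym u≈) (sym v≈)
          (*-cancelˡ w≉0 (x-y≈0⇒x≈y _ _ (begin
            w * (w * (t * t + α)) - w * slope-term t
              ≈⟨ solve 5 (λ w t α x y →
                   w :* (w :* (t :* t :+ α)) :- w :* (:- (con (ℤ.+ 2) :* (x :* t :+ α :* y)))
                   := ((x :+ w :* t) :* (x :+ w :* t) :+ α :* ((y :+ w) :* (y :+ w)))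
                      :- (x :* x :+ α :* (y :* y))) refl w t α u₀ v₀ ⟩
            ((u₀ + w * t) * (u₀ + w * t) + α * ((v₀ + w) * (v₀ + w))) - r
              ≈⟨ +-congʳ (+-cong (*-cong u≈ u≈) (*-congˡ (*-cong v≈ v≈))) ⟩
            (u * u + α * (v * v)) - r
              ≈⟨ x≈y⇒x-y≈0 eq ⟩
            0# ∎)))
        where
        w = v - v₀
        t = (u - u₀) * z

        t∈F : t ∈ F
        t∈F = *-closed (-‿closed u∈F u₀∈F) (inv-closed (-‿closed v∈F v₀∈F) wz≈1)

        v≈ : v₀ + w ≈ v
        v≈ = solve 2 (λ v x → x :+ (v :- x) := v) refl v v₀

        u≈ : u₀ + w * t ≈ u
        u≈ = begin
          u₀ + w * ((u - u₀) * z)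
            ≈⟨ +-congˡ (solve 3 (λ w z d → w :* (d :* z) := (w :* z) :* d) refl _ _ _) ⟩
          u₀ + (w * z) * (u - u₀)
            ≈⟨ +-congˡ (*-congʳ wz≈1) ⟩
          u₀ + 1# * (u - u₀)
            ≈⟨ solve 2 (λ u x → x :+ con (ℤ.+ 1) :* (u :- x) := u) refl u u₀ ⟩
          u ∎
      ... | yes v≈v₀ | no u≉u₀ = zero , sym (x-y≈0⇒x≈y _ _ (x*y≈0⇒y≈0 u≉u₀ (begin
        (u - u₀) * (u - - u₀)
          ≈⟨ solve 4 (λ u x α c → (u :- x) :* (u :- :- x)
               := (u :* u :+ α :* c) :- (x :* x :+ α :* c)) refl u u₀ α (v₀ * v₀) ⟩
        (u * u + α * (v₀ * v₀)) - r
          ≈⟨ +-congʳ (+-congˡ (*-congˡ (*-cong v≈ v≈))) ⟨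
        (u * u + α * (v * v)) - r
          ≈⟨ x≈y⇒x-y≈0 eq ⟩
        0# ∎))) , sym v≈
        where
        v≈ : v ≈ v₀
        v≈ = x-y≈0⇒x≈y _ _ v≈v₀
      -- The base point itself is reached along the tangent, of slope `- (α * v₀) / u₀`, with
      -- parameter `0#`.
      ... | yes v≈v₀ | yes u≈u₀ with z , u₀z≈1 ← inverse u₀ u₀≉0 =
        hit {t = - (α * v₀) * z}
          (*-closed (neg-closed (*-closed α∈F v₀∈F)) (inv-closed u₀∈F u₀z≈1))
          (trans (x-y≈0⇒x≈y _ _ u≈u₀) (solve 2 (λ x t → x := x :+ con (ℤ.+ 0) :* t) refl _ _))
          (trans (x-y≈0⇒x≈y _ _ v≈v₀) (sym (+-identityʳ v₀)))
          (begin
            0# * _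
              ≈⟨ solve 2 (λ w m → con (ℤ.+ 0) :* w
                   := :- (con (ℤ.+ 2) :* ((:- m) :* con (ℤ.+ 1) :+ m))) refl _ (α * v₀) ⟩
            - ((1# + 1#) * (- (α * v₀) * 1# + α * v₀))
              ≈⟨ -‿cong (*-congˡ (+-congʳ (*-congˡ u₀z≈1))) ⟨
            - ((1# + 1#) * (- (α * v₀) * (u₀ * z) + α * v₀))
              ≈⟨ -‿cong (*-congˡ (+-congʳ (solve 3 (λ m u z → m :* (u :* z)
                   := u :* (m :* z)) refl _ _ _))) ⟩
            - ((1# + 1#) * (u₀ * (- (α * v₀) * z) + α * v₀)) ∎)

    conic-size : HasSize (conicSetoid r) (suc q)
    conic-size = record
      { to        = λ k → point k , point-onConic k
      ; cong      = λ { ≡.refl → refl , refl }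
      ; bijective =
          (λ (u≈ , v≈) → point-injective u≈ v≈) ,
          λ (_ , on) → proj₁ (point-onto on) , λ { ≡.refl → proj₂ (point-onto on) }
      }

-- The configuration in integer coordinates.

-- The points c i = cx i + cy i ξ, that is ± 1 ± ξ, lie on the conic x₀² + α x₁² = 1 + α.
cx cy ce : Fin 4 → ℤ
cx 0F = 1ℤ
cx 1F = -1ℤ
cx 2F = 1ℤ
cx 3F = -1ℤ
cy 0F = 1ℤ
cy 1F = -1ℤ
cy 2F = -1ℤ
cy 3F = 1ℤ
ce i = cx i ℤ.* cy i

cx² : ∀ i → cx i ℤ.* cx i ≡ 1ℤ
cx² = from-yes (Fin.all? λ i → cx i ℤ.* cx i ℤ.≟ 1ℤ)

cy² : ∀ i → cy i ℤ.* cy i ≡ 1ℤ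
cy² = from-yes (Fin.all? λ i → cy i ℤ.* cy i ℤ.≟ 1ℤ)

-- Such integers have distinct images in any field in which 2 is invertible.
Separated : ℤ → ℤ → Set
Separated i j = i ℤ.- j ℤ.∣ ℤ.+ 8

separated? : ∀ i j → Dec (Separated i j)
separated? i j = i ℤ.- j ℤ.∣? ℤ.+ 8

-- These are the coordinates of the common point of blocks `i` and `j`: two for its `x`, and the
-- factor of `ξ` in its `y`. The value of `h` at `c i` is `2 * ce i`.
meetX meetY meetT : Fin 4 → Fin 4 → ℤ
meetX i j = cx i ℤ.+ cx j
meetY i j = cy i ℤ.+ cy j
meetT i j = ℤ.+ 2 ℤ.* (ce i ℤ.+ ce j)

-- The two integers have the same image if block j contains the common point of blocks i and l.
blocks-separated : ∀ i j → i ≡ j ⊎ ∃ λ l → Separated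
  (ℤ.+ 2 ℤ.* (meetX i l ℤ.- cx j) ℤ.* (meetY i l ℤ.- cy j))
  (meetT i l ℤ.+ ℤ.- (ℤ.+ 2 ℤ.* ce j))
blocks-separated = from-yes (Fin.all? λ i → Fin.all? λ j →
  i Fin.≟ j ⊎-dec Fin.any? λ l → separated?
    (ℤ.+ 2 ℤ.* (meetX i l ℤ.- cx j) ℤ.* (meetY i l ℤ.- cy j))
    (meetT i l ℤ.+ ℤ.- (ℤ.+ 2 ℤ.* ce j)))

-- The critical case is `0F , 1F` against `2F , 3F`: both pairs consist of opposite points, so
-- `meetX` and `meetY` vanish for both, and only `meetT` tells them apart, with values `4` and
-- `- 4`. Their difference is the 8 in `Separated`.
meetings-separated : ∀ i j k l → i Fin.< j → k Fin.< l →
  (i ≡ k × j ≡ l) ⊎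
  Separated (meetX i j) (meetX k l) ⊎
  Separated (meetY i j) (meetY k l) ⊎
  Separated (meetT i j) (meetT k l)
meetings-separated = from-yes
  (Fin.all? λ i → Fin.all? λ j → Fin.all? λ k → Fin.all? λ l →
    i Fin.<? j →-dec k Fin.<? l →-dec
    ((i Fin.≟ k ×-dec j Fin.≟ l) ⊎-dec
     separated? (meetX i j) (meetX k l) ⊎-dec
     separated? (meetY i j) (meetY k l) ⊎-dec
     separated? (meetT i j) (meetT k l)))

2xy≡2[e+xy]-2e : ∀ e x y → ℤ.+ 2 ℤ.* x ℤ.* y ≡
        ℤ.+ 2 ℤ.* (e ℤ.+ x ℤ.* y) ℤ.+ ℤ.- (ℤ.+ 2 ℤ.* e)
2xy≡2[e+xy]-2e = solve-∀

y≡x+[y-x] : ∀ a b → b ≡ a ℤ.+ (b ℤ.- a)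
y≡x+[y-x] = solve-∀

-- Blocks as conics, and the configuration for a function of the common shape.

module ONan {q : ℕ} (E : QuadraticExtension c ℓ ℓ′ q) where
  open QuadraticExtension E hiding (zero)
  open CommutativeSemiringExp commutativeSemiring
    using (_^_; ^-congˡ; ^-distrib-*)
  open IntegerCoefficients commutativeRing
  open FieldProperties commutativeRing isField
  open Solver using (solve; _:=_; _:+_; _:*_; _:-_; con)
  open RingProperties ring using (+-cancelʳ)
  open SetoidReasoning setoid
  open Subfield E

  -- Different `ξ`-coordinates would make `ξ` the quotient of `a′ - a` by `b - b′`, an element of
  -- `F`.
  coordinates-unique : ∀ {ξ} → ξ ∉ F → ∀ {a b a′ b′} →
                       a ∈ F → b ∈ F → a′ ∈ F → b′ ∈ F →
                       a + b * ξ ≈ a′ + b′ * ξ → a ≈ a′ × b ≈ b′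
  coordinates-unique {ξ} ξ∉F {a} {b} {a′} {b′} a∈F b∈F a′∈F b′∈F eq
    with b - b′ ≟ 0#
  ... | yes b≈b′ =
    +-cancelʳ _ _ _ (trans eq (+-congˡ (*-congʳ (sym (x-y≈0⇒x≈y _ _ b≈b′))))) ,
    x-y≈0⇒x≈y _ _ b≈b′
  ... | no  b≉b′ with z , dz≈1 ← inverse _ b≉b′ = contradiction
    (resp (begin
        (a′ - a) * z
          ≈⟨ *-congʳ (solve 5 (λ a b a′ b′ x → a′ :- a
               := (b :- b′) :* x :+ ((a′ :+ b′ :* x) :- (a :+ b :* x))) refl a b a′ b′ ξ) ⟩
        ((b - b′) * ξ + ((a′ + b′ * ξ) - (a + b * ξ))) * z
          ≈⟨ *-congʳ (+-congˡ (x≈y⇒x-y≈0 (sym eq))) ⟩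
        ((b - b′) * ξ + 0#) * z
          ≈⟨ solve 3 (λ d x z → (d :* x :+ con (ℤ.+ 0)) :* z := x :* (d :* z)) refl _ ξ z ⟩
        ξ * ((b - b′) * z)
          ≈⟨ *-congˡ dz≈1 ⟩
        ξ * 1#
          ≈⟨ *-identityʳ ξ ⟩
        ξ ∎)
      (*-closed (-‿closed a′∈F a∈F) (inv-closed (-‿closed b∈F b′∈F) dz≈1)))
    ξ∉F

  module _
    {ξ : Carrier} (ξ∉F : ξ ∉ F)
    {α : Carrier} (α∈F : α ∈ F) (2≉0 : 1# + 1# ≉ 0#)
    (anisotropic : ∀ {t} → t ∈ F → t * t + α ≉ 0#)
    (m k : ℕ) (^m-injective : InjectiveOnF (_^ m)) (^k-injective : InjectiveOnF (_^ k))
    (decompose : ∀ x → ∃₂ λ x₀ x₁ → x₀ ∈ F × x₁ ∈ F × x ≈ x₀ + x₁ * ξ)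
    (f : Carrier → Carrier)
    (f-coordinates : ∀ {x x₀ x₁} → x₀ ∈ F → x₁ ∈ F → x ≈ x₀ + x₁ * ξ →
      f x ≈ (x₀ ^ m * x₀ ^ m + α * (x₁ ^ k * x₁ ^ k)) + (1# + 1#) * x₀ * x₁ * ξ)
    where

    open Plane commutativeRing f
    open Unital E f ξ
    open Conic E {α}

    unique : ∀ {a b a′ b′} → a ∈ F → b ∈ F → a′ ∈ F → b′ ∈ F →
             a + b * ξ ≈ a′ + b′ * ξ → a ≈ a′ × b ≈ b′
    unique = coordinates-unique ξ∉F

    2∈F : 1# + 1# ∈ F
    2∈F = +-closed 1∈F 1∈F

    module _ (a : Carrier) {r s : Carrier} (r∈F : r ∈ F) (s∈F : s ∈ F) where

      private
        b = r + s * ξ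

        block : Pred Point _
        block = 𝒰 ∩ pointsOf (L a b)

        blockSetoid = subsetoid pointSetoid block

        norm : Carrier → Carrier → Carrier
        norm x₀ x₁ = x₀ ^ m * x₀ ^ m + α * (x₁ ^ k * x₁ ^ k)

        norm∈F : ∀ {x₀ x₁} → x₀ ∈ F → x₁ ∈ F → norm x₀ x₁ ∈ F
        norm∈F x₀∈F x₁∈F = +-closed
          (*-closed (^-closed m x₀∈F) (^-closed m x₀∈F))
          (*-closed α∈F (*-closed (^-closed k x₁∈F) (^-closed k x₁∈F)))

      -- Both equations are read off from `f (x + a) ≈ t * ξ + b`. The first is a condition on `x`
      -- alone, while the second only determines `t`; so counting the block amounts to counting the
      -- solutions of the first.
      block-point : ∀ {x t x₀ x₁} → t ∈ F → x₀ ∈ F → x₁ ∈ F →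
                    x + a ≈ x₀ + x₁ * ξ → t * ξ ≈ f (x + a) - b →
                    norm x₀ x₁ ≈ r × (1# + 1#) * x₀ * x₁ ≈ t + s
      block-point {x} {t} {x₀} {x₁} t∈F x₀∈F x₁∈F x+a≈ tξ≈ =
        unique (norm∈F x₀∈F x₁∈F) (*-closed (*-closed 2∈F x₀∈F) x₁∈F) r∈F
          (+-closed t∈F s∈F) (begin
            norm x₀ x₁ + (1# + 1#) * x₀ * x₁ * ξ
              ≈⟨ f-coordinates x₀∈F x₁∈F x+a≈ ⟨
            f (x + a)
              ≈⟨ solve 2 (λ y b → y := (y :- b) :+ b) refl _ b ⟩
            (f (x + a) - b) + b
              ≈⟨ +-congʳ tξ≈ ⟨
            t * ξ + (r + s * ξ)
              ≈⟨ solve 4 (λ t s r x → t :* x :+ (r :+ s :* x) := r :+ (t :+ s) :* x)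
                   refl t s r ξ ⟩
            r + (t + s) * ξ ∎)

      point∈block : ∀ {x t x₀ x₁} → t ∈ F → x₀ ∈ F → x₁ ∈ F →
                    x + a ≈ x₀ + x₁ * ξ → norm x₀ x₁ ≈ r →
                    (1# + 1#) * x₀ * x₁ ≈ t + s → aff x (t * ξ) ∈ block
      point∈block {x} {t} {x₀} {x₁} t∈F x₀∈F x₁∈F x+a≈ norm≈ 2x₀x₁≈ =
        aff∈𝒰 t t∈F refl , aff∈L (begin
          t * ξ
            ≈⟨ solve 4 (λ t s r x → t :* x := (r :+ (t :+ s) :* x) :- (r :+ s :* x))
                 refl t s r ξ ⟩
          (r + (t + s) * ξ) - b
            ≈⟨ +-congʳ (+-cong norm≈ (*-congʳ 2x₀x₁≈)) ⟨
          (norm x₀ x₁ + (1# + 1#) * x₀ * x₁ * ξ) - b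
            ≈⟨ +-congʳ (f-coordinates x₀∈F x₁∈F x+a≈) ⟨
          f (x + a) - b ∎)

      private
        coordinates : ∀ x {x₀ x₁} → x₀ ∈ F → x₁ ∈ F → x ≈ x₀ + x₁ * ξ →
                      proj₁ (decompose x) ≈ x₀ × proj₁ (proj₂ (decompose x)) ≈ x₁
        coordinates x x₀∈F x₁∈F x≈ = let _ , _ , y₀∈F , y₁∈F , x≈′ = decompose x in
          unique y₀∈F y₁∈F x₀∈F x₁∈F (trans (sym x≈′) x≈)

        toConic : ∃ block → ∃ (OnConic r)
        toConic (aff x y , aff∈𝒰 t t∈F y≈tξ , aff∈L y≈)
          with x₀ , x₁ , x₀∈F , x₁∈F , x+a≈ ← decompose (x + a) =
          (x₀ ^ m , x₁ ^ k) , ^-closed m x₀∈F , ^-closed k x₁∈F ,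
          proj₁ (block-point t∈F x₀∈F x₁∈F x+a≈ (trans (sym y≈tξ) y≈))
        toConic (∞ , ∞∈𝒰 , ())

        toConic-cong : ∀ {P Q} → Setoid._≈_ blockSetoid P Q →
                       Setoid._≈_ (conicSetoid r) (toConic P) (toConic Q)
        toConic-cong {aff x _ , aff∈𝒰 _ _ _ , aff∈L _} {aff x′ _ , aff∈𝒰 _ _ _ , aff∈L _}
          (aff x≈x′ _)
          with x₀ , x₁ , x₀∈F , x₁∈F , x+a≈ ← decompose (x + a)
             | x₀′ , x₁′ , x₀′∈F , x₁′∈F , x′+a≈ ← decompose (x′ + a)
          with x₀≈ , x₁≈ ← unique x₀∈F x₁∈F x₀′∈F x₁′∈F
                             (trans (sym x+a≈) (trans (+-congʳ x≈x′) x′+a≈)) =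
          ^-congˡ m x₀≈ , ^-congˡ k x₁≈
        toConic-cong {∞ , ∞∈𝒰 , ()}

        toConic-injective : ∀ {P Q} → Setoid._≈_ (conicSetoid r) (toConic P) (toConic Q) →
                            Setoid._≈_ blockSetoid P Q
        toConic-injective {aff x y , aff∈𝒰 _ _ _ , aff∈L y≈}
                          {aff x′ y′ , aff∈𝒰 _ _ _ , aff∈L y′≈} (u≈ , v≈)
          with x₀ , x₁ , x₀∈F , x₁∈F , x+a≈ ← decompose (x + a)
             | x₀′ , x₁′ , x₀′∈F , x₁′∈F , x′+a≈ ← decompose (x′ + a) =
          aff (+-cancelʳ a _ _ (trans x+a≈x₀′+x₁′ξ (sym x′+a≈))) (begin
            y               ≈⟨ y≈ ⟩
            f (x + a) - b   ≈⟨ +-congʳ (f-coordinates x₀′∈F x₁′∈F x+a≈x₀′+x₁′ξ) ⟩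
            _ - b           ≈⟨ +-congʳ (f-coordinates x₀′∈F x₁′∈F x′+a≈) ⟨
            f (x′ + a) - b  ≈⟨ y′≈ ⟨
            y′              ∎)
          where
          x+a≈x₀′+x₁′ξ : x + a ≈ x₀′ + x₁′ * ξ
          x+a≈x₀′+x₁′ξ = trans x+a≈ (+-cong (^m-injective x₀∈F x₀′∈F u≈)
            (*-congʳ (^k-injective x₁∈F x₁′∈F v≈)))
        toConic-injective {aff _ _ , _} {∞ , ∞∈𝒰 , ()}
        toConic-injective {∞ , ∞∈𝒰 , ()}

        fromConic : ∀ c → ∃ λ P → Setoid._≈_ (conicSetoid r) (toConic P) c
        fromConic ((u , v) , u∈F , v∈F , on)
          with x₀ , x₀∈F , x₀^m≈u ← injective⇒onto (^-closed m) ^m-injective u∈F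
             | x₁ , x₁∈F , x₁^k≈v ← injective⇒onto (^-closed k) ^k-injective v∈F =
          (aff x (t * ξ) , aff∈𝒰 t t∈F refl , proj₂ P∈block) ,
          trans (^-congˡ m (proj₁ c≈)) x₀^m≈u , trans (^-congˡ k (proj₂ c≈)) x₁^k≈v
          where
          x = (x₀ + x₁ * ξ) - a
          t = (1# + 1#) * x₀ * x₁ - s

          t∈F : t ∈ F
          t∈F = -‿closed (*-closed (*-closed 2∈F x₀∈F) x₁∈F) s∈F

          x+a≈ : x + a ≈ x₀ + x₁ * ξ
          x+a≈ = solve 2 (λ y a → (y :- a) :+ a := y) refl _ a

          c≈ = coordinates (x + a) x₀∈F x₁∈F x+a≈

          P∈block : aff x (t * ξ) ∈ block
          P∈block = point∈block t∈F x₀∈F x₁∈F x+a≈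
            (trans (+-cong (*-cong x₀^m≈u x₀^m≈u) (*-congˡ (*-cong x₁^k≈v x₁^k≈v))) on)
            (solve 2 (λ y s → y := (y :- s) :+ s) refl _ s)

      -- Since both powers permute `F`, the pair `(x₀ ^ m , x₁ ^ k)` determines `x + a`, and every
      -- point of the conic arises in this way.
      block⤖conic : Bijection blockSetoid (conicSetoid r)
      block⤖conic = record
        { to        = toConic
        ; cong      = λ {P} {Q} → toConic-cong {P} {Q}
        ; bijective = (λ {P} {Q} → toConic-injective {P} {Q}) ,
            λ c → proj₁ (fromConic c) , λ {Q} Q≈P →
              Setoid.trans (conicSetoid r) {toConic Q} {toConic (proj₁ (fromConic c))} {c}
                (toConic-cong {Q} {proj₁ (fromConic c)} Q≈P) (proj₂ (fromConic c))
        }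

    -- The constant is left unsimplified: it is the value of the quadratic form at `(1# , 1#)`, the
    -- base point from which the conic is counted.
    block-size : ∀ a {s} → s ∈ F →
                 HasSize (subsetoid pointSetoid
                           (𝒰 ∩ pointsOf (L a ((1# * 1# + α * (1# * 1#)) + s * ξ))))
                         (q ℕ.+ 1)
    block-size a s∈F = ≡.subst (HasSize _) (ℕ.+-comm 1 q)
      (HasSize-pullback
        (block⤖conic a (+-closed (*-closed 1∈F 1∈F) (*-closed α∈F (*-closed 1∈F 1∈F))) s∈F)
        (conic-size α∈F 2≉0 anisotropic 1∈F 1∈F (λ 1≈0 → 0≉1 (sym 1≈0))))

    -- Otherwise `8 = d * (i - j)` would vanish in the field, although it is the cube of the nonzero
    -- element `1# + 1#`.
    separated : ∀ i j → Separated i j → ι i ≉ ι j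
    separated i j (ℤ.divides d 8≡) i≈j = *-nonzero 2≉0 (*-nonzero 2≉0 2≉0) (begin
      (1# + 1#) * ((1# + 1#) * (1# + 1#))
        ≈⟨ solve 0 (con (ℤ.+ 2) :* (con (ℤ.+ 2) :* con (ℤ.+ 2)) := con (ℤ.+ 8)) refl ⟩
      ι (ℤ.+ 8)
        ≡⟨ ≡.cong ι 8≡ ⟩
      ι (d ℤ.* (i ℤ.- j))
        ≈⟨ ι-* d (i ℤ.- j) ⟩
      ι d * ι (i ℤ.- j)
        ≈⟨ *-congˡ (trans (ι-+ i (ℤ.- j)) (+-congˡ (ι-neg j))) ⟩
      ι d * (ι i - ι j)
        ≈⟨ *-congˡ (x≈y⇒x-y≈0 i≈j) ⟩
      ι d * 0#
        ≈⟨ zeroʳ _ ⟩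
      0# ∎)

    private
      r = 1# * 1# + α * (1# * 1#)

      r∈F : r ∈ F
      r∈F = +-closed (*-closed 1∈F 1∈F) (*-closed α∈F (*-closed 1∈F 1∈F))

      line : Fin 4 → Line
      line i = L (- (ι (cx i) + ι (cy i) * ξ)) (r + ι (ℤ.- (ℤ.+ 2 ℤ.* ce i)) * ξ)

      block : Fin 4 → Pred Point _
      block i = 𝒰 ∩ pointsOf (line i)

      point : ℤ → ℤ → ℤ → Point
      point x y t = aff (ι x + ι y * ξ) (ι t * ξ)

      meeting : Fin 4 → Fin 4 → Point
      meeting i j = point (meetX i j) (meetY i j) (meetT i j)

      -- Signs disappear in the square of a power, which is why the four points have the same norm
      -- for all exponents.
      ι-unit : ∀ i n → i ℤ.* i ≡ 1ℤ → ι i ^ n * ι i ^ n ≈ 1# * 1#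
      ι-unit i n i²≡1 = begin
        ι i ^ n * ι i ^ n    ≈⟨ ^-distrib-* (ι i) (ι i) n ⟨
        (ι i * ι i) ^ n      ≈⟨ ^-congˡ n (ι-* i i) ⟨
        ι (i ℤ.* i) ^ n      ≡⟨ ≡.cong (λ j → ι j ^ n) i²≡1 ⟩
        1# ^ n               ≈⟨ 1^ n ⟩
        1#                   ≈⟨ *-identityˡ 1# ⟨
        1# * 1#              ∎
        where
        1^ : ∀ n → 1# ^ n ≈ 1#
        1^ zero    = refl
        1^ (suc n) = trans (*-identityˡ _) (1^ n)

      translate : ∀ i {x y} x′ y′ → x ≡ cx i ℤ.+ x′ → y ≡ cy i ℤ.+ y′ →
                  (ι x + ι y * ξ) - (ι (cx i) + ι (cy i) * ξ) ≈ ι x′ + ι y′ * ξ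
      translate i x′ y′ ≡.refl ≡.refl = begin
        (ι (cx i ℤ.+ x′) + ι (cy i ℤ.+ y′) * ξ) - (ι (cx i) + ι (cy i) * ξ)
          ≈⟨ +-congʳ (+-cong (ι-+ (cx i) x′) (*-congʳ (ι-+ (cy i) y′))) ⟩
        ((ι (cx i) + ι x′) + (ι (cy i) + ι y′) * ξ) - (ι (cx i) + ι (cy i) * ξ)
          ≈⟨ solve 5 (λ a b c d x → ((a :+ b) :+ (c :+ d) :* x) :- (a :+ c :* x)
               := b :+ d :* x) refl _ _ _ _ ξ ⟩
        ι x′ + ι y′ * ξ ∎

      double : ∀ x y → (1# + 1#) * ι x * ι y ≈ ι (ℤ.+ 2 ℤ.* x ℤ.* y)
      double x y = sym (trans (ι-* (ℤ.+ 2 ℤ.* x) y) (*-congʳ (ι-* (ℤ.+ 2) x)))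

      meeting∈block : ∀ i j → meeting i j ∈ block i
      meeting∈block i j = point∈block _ r∈F
        (ι∈F (ℤ.- (ℤ.+ 2 ℤ.* ce i))) (ι∈F (meetT i j)) (ι∈F (cx j)) (ι∈F (cy j))
        (translate i {meetX i j} {meetY i j} (cx j) (cy j) ≡.refl ≡.refl)
        (+-cong (ι-unit (cx j) m (cx² j)) (*-congˡ (ι-unit (cy j) k (cy² j))))
        (begin
          (1# + 1#) * ι (cx j) * ι (cy j)
            ≈⟨ double (cx j) (cy j) ⟩
          ι (ℤ.+ 2 ℤ.* cx j ℤ.* cy j)
            ≡⟨ ≡.cong ι (2xy≡2[e+xy]-2e (ce i) (cx j) (cy j)) ⟩
          ι (meetT i j ℤ.+ ℤ.- (ℤ.+ 2 ℤ.* ce i))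
            ≈⟨ ι-+ (meetT i j) _ ⟩
          ι (meetT i j) + ι (ℤ.- (ℤ.+ 2 ℤ.* ce i)) ∎)

      meeting-comm : ∀ i j → meeting i j ≡ meeting j i
      meeting-comm i j
        rewrite ℤ.+-comm (cx i) (cx j) | ℤ.+-comm (cy i) (cy j) | ℤ.+-comm (ce i) (ce j) = ≡.refl

      -- Only the `ξ`-coordinate of the incidence is tested: it is a fixed integer polynomial in the
      -- coordinates, whereas the other one involves the exponents.
      separating-meeting : ∀ i j l → Separated
        (ℤ.+ 2 ℤ.* (meetX i l ℤ.- cx j) ℤ.* (meetY i l ℤ.- cy j))
        (meetT i l ℤ.+ ℤ.- (ℤ.+ 2 ℤ.* ce j)) →
        meeting i l ∉ block j
      separating-meeting i j l sep (_ , aff∈L on) = separated lhs rhs sep (begin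
        ι lhs
          ≈⟨ double x y ⟨
        (1# + 1#) * ι x * ι y
          ≈⟨ proj₂ (block-point _ r∈F (ι∈F (ℤ.- (ℤ.+ 2 ℤ.* ce j))) (ι∈F (meetT i l))
               (ι∈F x) (ι∈F y)
               (translate j {meetX i l} {meetY i l} x y
                 (y≡x+[y-x] (cx j) (meetX i l)) (y≡x+[y-x] (cy j) (meetY i l))) on) ⟩
        ι (meetT i l) + ι (ℤ.- (ℤ.+ 2 ℤ.* ce j))
          ≈⟨ ι-+ (meetT i l) _ ⟨
        ι rhs ∎)
        where
        x   = meetX i l ℤ.- cx j
        y   = meetY i l ℤ.- cy j
        lhs = ℤ.+ 2 ℤ.* x ℤ.* y
        rhs = meetT i l ℤ.+ ℤ.- (ℤ.+ 2 ℤ.* ce j)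

      blocks-distinct : ∀ {i j} → i ≢ j → ¬ (block i ≐ block j)
      blocks-distinct {i} {j} i≢j (⊆ , _) =
        [ i≢j , (λ (l , sep) → separating-meeting i j l sep (⊆ (meeting∈block i l))) ]′
          (blocks-separated i j)

      meeting-distinct : ∀ {i j k l} → i Fin.< j → k Fin.< l →
                         meeting i j ≈ₚ meeting k l → i ≡ k × j ≡ l
      meeting-distinct {i} {j} {k} {l} i<j k<l (aff x≈ y≈) =
        [ (λ eq → eq)
        , [ contradiction (proj₁ x₀≈×x₁≈) ∘ separated (meetX i j) (meetX k l)
          , [ contradiction (proj₂ x₀≈×x₁≈) ∘ separated (meetY i j) (meetY k l)
            , contradiction (proj₂ t≈) ∘ separated (meetT i j) (meetT k l)
            ]′
          ]′
        ]′ (meetings-separated i j k l i<j k<l)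
        where
        x₀≈×x₁≈ = unique (ι∈F (meetX i j)) (ι∈F (meetY i j))
                    (ι∈F (meetX k l)) (ι∈F (meetY k l)) x≈
        t≈ = unique 0∈F (ι∈F (meetT i j)) 0∈F (ι∈F (meetT k l)) (+-congˡ y≈)

    containsONan : ContainsONan
    containsONan = record
      { line            = line
      ; block-size      = λ i → block-size _ (ι∈F (ℤ.- (ℤ.+ 2 ℤ.* ce i)))
      ; blocks-distinct = blocks-distinct
      ; meet            = λ {i} {j} _ → meeting i j
      ; meet∈           = λ {i} {j} _ → meeting∈block i j ,
          ≡.subst (_∈ block j) (meeting-comm j i) (meeting∈block j i)
      ; meet-distinct   = meeting-distinct
      }

-- Parity and exponent arithmetic in the natural numbers.

odd : ∀ {n} → ¬ 2 ∣ n → ∃ λ t → n ≡ 1 ℕ.+ t ℕ.* 2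
odd {n} 2∤n with n divMod 2
... | result t 0F n≡ = contradiction (divides t n≡) 2∤n
... | result t 1F n≡ = t , n≡

odd-^ : ∀ {p} → ¬ 2 ∣ p → ∀ k → ¬ 2 ∣ p ℕ.^ k
odd-^ 2∤p zero    2∣1 = contradiction (∣1⇒≡1 2∣1) λ ()
odd-^ 2∤p (suc k) 2∣  = [ 2∤p , odd-^ 2∤p k ]′ (euclidsLemma _ _ prime[2] 2∣)

odd-prime : ∀ {p} → Prime p → p ≢ 2 → ¬ 2 ∣ p
odd-prime p-prime p≢2 2∣p =
  [ (λ ()) , (λ 2≡p → p≢2 (≡.sym 2≡p)) ]′ (prime⇒irreducible p-prime 2∣p)

half-successor : ∀ {p} → ¬ 2 ∣ p → ∀ k → ∃ λ m → p ℕ.^ k ℕ.+ 1 ≡ m ℕ.+ m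
half-successor 2∤p k with t , p^k≡ ← odd (odd-^ 2∤p k) =
  1 ℕ.+ t , ≡.trans (≡.cong (ℕ._+ 1) p^k≡)
    (solve 1 (λ t → con 1 :+ t :* con 2 :+ con 1 := (con 1 :+ t) :+ (con 1 :+ t)) ≡.refl t)
  where open +-*-Solver

-- With `e = n / gcd k n` and `j = k / gcd k n` one has `k * e ≡ n * j`. The left side splits the
-- `e` factors `P` into `t` pairs and a single one, ready for an element fixed by the power `P * P`;
-- the right side is an exponent that fixes all of `F`.
odd-iterate : ∀ p k n t → quotient (gcd[m,n]∣n k n) ≡ 1 ℕ.+ t ℕ.* 2 →
              (p ℕ.^ k ℕ.* p ℕ.^ k) ℕ.^ t ℕ.* p ℕ.^ k ≡ (p ℕ.^ n) ℕ.^ quotient (gcd[m,n]∣m k n)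
odd-iterate p k n t e≡ = begin
  (P ℕ.* P) ℕ.^ t ℕ.* P            ≡⟨ ℕ.*-comm _ P ⟩
  P ℕ.* (P ℕ.* P) ℕ.^ t            ≡⟨ ≡.cong (λ a → P ℕ.* (P ℕ.* a) ℕ.^ t) (ℕ.*-identityʳ P) ⟨
  P ℕ.* (P ℕ.^ 2) ℕ.^ t              ≡⟨ ≡.cong (P ℕ.*_) (ℕ.^-*-assoc P 2 t) ⟩
  P ℕ.^ (1 ℕ.+ 2 ℕ.* t)            ≡⟨ ≡.cong (λ a → P ℕ.^ (1 ℕ.+ a)) (ℕ.*-comm 2 t) ⟩
  P ℕ.^ (1 ℕ.+ t ℕ.* 2)            ≡⟨ ≡.cong (P ℕ.^_) e≡ ⟨
  P ℕ.^ e                          ≡⟨ ℕ.^-*-assoc p k e ⟩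
  p ℕ.^ (k ℕ.* e)                  ≡⟨ ≡.cong (p ℕ.^_) k*e≡n*j ⟩
  p ℕ.^ (n ℕ.* j)                  ≡⟨ ℕ.^-*-assoc p n j ⟨
  (p ℕ.^ n) ℕ.^ j                    ∎
  where
  open ≡.≡-Reasoning
  P = p ℕ.^ k
  e = quotient (gcd[m,n]∣n k n)
  j = quotient (gcd[m,n]∣m k n)

  k*e≡n*j : k ℕ.* e ≡ n ℕ.* j
  k*e≡n*j = begin
    k ℕ.* e                     ≡⟨ ≡.cong (ℕ._* e) (_∣_.equality (gcd[m,n]∣m k n)) ⟩
    j ℕ.* gcd k n ℕ.* e         ≡⟨ ℕ.*-assoc j (gcd k n) e ⟩
    j ℕ.* (gcd k n ℕ.* e)       ≡⟨ ≡.cong (j ℕ.*_) (ℕ.*-comm (gcd k n) e) ⟩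
    j ℕ.* (e ℕ.* gcd k n)       ≡⟨ ≡.cong (j ℕ.*_) (_∣_.equality (gcd[m,n]∣n k n)) ⟨
    j ℕ.* n                     ≡⟨ ℕ.*-comm j n ⟩
    n ℕ.* j                     ∎

-- Which power maps are injective on `F`.

module PowerMaps {q : ℕ} (E : QuadraticExtension c ℓ ℓ′ (suc q))
                 {p n : ℕ} (q≡p^n : suc q ≡ p ℕ.^ n) where
  open QuadraticExtension E hiding (zero)
  open CommutativeSemiringExp commutativeSemiring
    using (_^_; ^-congˡ; ^-congʳ; ^-assocʳ; ^-distrib-*; ^-homo-*)
  open IntegerCoefficients commutativeRing
  open FieldProperties commutativeRing isField
  open Solver using (solve; _:=_; _:+_; _:*_; _:-_; :-_; con)
  open SetoidReasoning setoid
  open Subfield E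
  open Units E

  1^ : ∀ k → 1# ^ k ≈ 1#
  1^ zero    = refl
  1^ (suc k) = trans (*-identityˡ _) (1^ k)

  ^-fixed : ∀ {x} k → x ^ k ≈ x → ∀ j → x ^ (k ℕ.^ j) ≈ x
  ^-fixed {x} k x^k≈x zero    = *-identityʳ x
  ^-fixed {x} k x^k≈x (suc j) = begin
    x ^ (k ℕ.* k ℕ.^ j)      ≈⟨ ^-assocʳ x k (k ℕ.^ j) ⟨
    (x ^ k) ^ (k ℕ.^ j)     ≈⟨ ^-congˡ (k ℕ.^ j) x^k≈x ⟩
    x ^ (k ℕ.^ j)            ≈⟨ ^-fixed k x^k≈x j ⟩
    x                       ∎

  x^p^n≈x : ∀ {x} → x ∈ F → x ^ (p ℕ.^ n) ≈ x
  x^p^n≈x {x} x∈F = trans (^-congʳ x (≡.sym q≡p^n)) (x^∣F∣≈x x∈F)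

  ^-injective-∘ : ∀ j k → InjectiveOnF (_^ j) → InjectiveOnF (_^ k) →
                  InjectiveOnF (_^ (j ℕ.* k))
  ^-injective-∘ j k j-injective k-injective {x} {y} x∈F y∈F eq =
    j-injective x∈F y∈F (k-injective (^-closed j x∈F) (^-closed j y∈F)
      (trans (^-assocʳ x j k) (trans eq (sym (^-assocʳ y j k)))))

  ^-injective-factor : ∀ j k → InjectiveOnF (_^ (j ℕ.* k)) → InjectiveOnF (_^ j)
  ^-injective-factor j k jk-injective {x} {y} x∈F y∈F eq = jk-injective x∈F y∈F
    (trans (sym (^-assocʳ x j k)) (trans (^-congˡ k eq) (^-assocʳ y j k)))

  -- Following this map by the power `p ^ (n ∸ i)` gives the power `p ^ n`, the identity of `F`.
  frobenius-injective : ∀ {i} → i ℕ.< n → InjectiveOnF (_^ (p ℕ.^ i))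
  frobenius-injective {i} i<n = ^-injective-factor (p ℕ.^ i) (p ℕ.^ (n ℕ.∸ i))
    (≡.subst (λ k → InjectiveOnF (_^ k)) p^n≡
      (λ x∈F y∈F eq → trans (sym (x^p^n≈x x∈F)) (trans eq (x^p^n≈x y∈F))))
    where
    p^n≡ : p ℕ.^ n ≡ p ℕ.^ i ℕ.* p ℕ.^ (n ℕ.∸ i)
    p^n≡ = ≡.trans (≡.cong (p ℕ.^_) (≡.sym (ℕ.m+[n∸m]≡n (ℕ.<⇒≤ i<n))))
                   (ℕ.^-distribˡ-+-* p i (n ℕ.∸ i))

  module _ {y} (y∈F : y ∈ F) (y²≈-1 : y * y ≈ - 1#) where

    -- A zero would give `α ≈ - (t * t) ≈ (y * t) * (y * t)`, a square in `F`.
    anisotropic : ∀ {α} → Nonsquare α → ∀ {t} → t ∈ F → t * t + α ≉ 0#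
    anisotropic {α} (_ , α-nonsquare) {t} t∈F eq =
      α-nonsquare (y * t , *-closed y∈F t∈F , (begin
        (y * t) * (y * t)
          ≈⟨ solve 2 (λ y t → (y :* t) :* (y :* t) := (y :* y) :* (t :* t)) refl y t ⟩
        (y * y) * (t * t)
          ≈⟨ *-congʳ y²≈-1 ⟩
        - 1# * (t * t)
          ≈⟨ solve 2 (λ t a → (:- con (ℤ.+ 1)) :* t := a :- (t :+ a)) refl (t * t) α ⟩
        α - (t * t + α)
          ≈⟨ +-congˡ (-‿cong eq) ⟩
        α - 0#
          ≈⟨ solve 1 (λ a → a :- con (ℤ.+ 0) := a) refl α ⟩
        α ∎))

    module _ (2≉0 : 1# + 1# ≉ 0#) (k : ℕ) (2∤n/gcd : ¬ 2 ∣ quotient (gcd[m,n]∣n k n)) where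

      private
        j P : ℕ
        j = quotient (gcd[m,n]∣m k n)
        P = p ℕ.^ k

      -- x ↦ x ^ P inverts z, so its iterates of odd order do too; but the
      -- (n / gcd k n)-th iterate is the identity of F.
      z^[P+1]≈1⇒z²≈1 : ∀ {z} → z ∈ F → z ^ (P ℕ.+ 1) ≈ 1# → z * z ≈ 1#
      z^[P+1]≈1⇒z²≈1 {z} z∈F eq with t , e≡ ← odd 2∤n/gcd = trans (*-congʳ z≈w) w*z≈1
        where
        w = z ^ P

        w*z≈1 : w * z ≈ 1#
        w*z≈1 = begin
          w * z          ≈⟨ *-congˡ (*-identityʳ z) ⟨
          w * z ^ 1     ≈⟨ ^-homo-* z P 1 ⟨
          z ^ (P ℕ.+ 1) ≈⟨ eq ⟩
          1#             ∎

        w≉0 : w ≉ 0#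
        w≉0 w≈0 = 0≉1 (trans (sym (zeroˡ z)) (trans (*-congʳ (sym w≈0)) w*z≈1))

        z^PP≈z : z ^ (P ℕ.* P) ≈ z
        z^PP≈z = *-cancelˡ w≉0 (begin
          w * z ^ (P ℕ.* P)   ≈⟨ *-congˡ (^-assocʳ z P P) ⟨
          w * w ^ P           ≈⟨ *-comm _ _ ⟩
          w ^ P * z ^ P      ≈⟨ ^-distrib-* w z P ⟨
          (w * z) ^ P         ≈⟨ ^-congˡ P w*z≈1 ⟩
          1# ^ P              ≈⟨ 1^ P ⟩
          1#                   ≈⟨ w*z≈1 ⟨
          w * z                ∎)

        z≈w : z ≈ w
        z≈w = begin
          z                                  ≈⟨ ^-fixed (p ℕ.^ n) (x^p^n≈x z∈F) j ⟨
          z ^ ((p ℕ.^ n) ℕ.^ j)                 ≈⟨ ^-congʳ z (odd-iterate p k n t e≡) ⟨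
          z ^ ((P ℕ.* P) ℕ.^ t ℕ.* P)         ≈⟨ ^-assocʳ z ((P ℕ.* P) ℕ.^ t) P ⟨
          (z ^ ((P ℕ.* P) ℕ.^ t)) ^ P        ≈⟨ ^-congˡ P (^-fixed (P ℕ.* P) z^PP≈z t) ⟩
          w                                  ∎

      module _ (m : ℕ) (P+1≡2m : P ℕ.+ 1 ≡ m ℕ.+ m) where

        -- Otherwise y ^ (P + 1) ≈ 1#, because y ^ 4 ≈ 1#.
        half-odd : ¬ 2 ∣ m
        half-odd (divides s m≡) = 2≉0 (begin
          1# + 1#
            ≈⟨ +-congˡ (z^[P+1]≈1⇒z²≈1 y∈F y^[P+1]≈1) ⟨
          1# + y * y
            ≈⟨ +-congˡ y²≈-1 ⟩
          1# - 1#
            ≈⟨ -‿inverseʳ 1# ⟩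
          0# ∎)
          where
          y^m≈ : y ^ m ≈ (- 1#) ^ s
          y^m≈ = begin
            y ^ m            ≈⟨ ^-congʳ y (≡.trans m≡ (ℕ.*-comm s 2)) ⟩
            y ^ (2 ℕ.* s)    ≈⟨ ^-assocʳ y 2 s ⟨
            (y ^ 2) ^ s     ≈⟨ ^-congˡ s (*-congˡ (*-identityʳ y)) ⟩
            (y * y) ^ s      ≈⟨ ^-congˡ s y²≈-1 ⟩
            (- 1#) ^ s       ∎

          y^[P+1]≈1 : y ^ (P ℕ.+ 1) ≈ 1#
          y^[P+1]≈1 = begin
            y ^ (P ℕ.+ 1)               ≈⟨ ^-congʳ y P+1≡2m ⟩
            y ^ (m ℕ.+ m)               ≈⟨ ^-homo-* y m m ⟩
            y ^ m * y ^ m              ≈⟨ *-cong y^m≈ y^m≈ ⟩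
            (- 1#) ^ s * (- 1#) ^ s    ≈⟨ ^-distrib-* (- 1#) (- 1#) s ⟨
            (- 1# * - 1#) ^ s           ≈⟨ ^-congˡ s (solve 0
              ((:- con (ℤ.+ 1)) :* (:- con (ℤ.+ 1)) := con (ℤ.+ 1)) refl) ⟩
            1# ^ s                      ≈⟨ 1^ s ⟩
            1#                           ∎

        -- Squaring the hypothesis gives `z ^ (P + 1) ≈ 1#`, hence `z² ≈ 1#`; as `m` is odd, `z ^ m`
        -- is then `z` itself.
        half-power-kernel : ∀ {z} → z ∈ F → z ^ m ≈ 1# → z ≈ 1#
        half-power-kernel {z} z∈F z^m≈1 with s , m≡ ← odd half-odd = begin
          z                        ≈⟨ *-identityʳ z ⟨
          z * 1#                   ≈⟨ *-congˡ (1^ s) ⟨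
          z * 1# ^ s              ≈⟨ *-congˡ (^-congˡ s z^2≈1) ⟨
          z * (z ^ 2) ^ s        ≈⟨ *-congˡ (^-assocʳ z 2 s) ⟩
          z ^ (1 ℕ.+ 2 ℕ.* s)     ≈⟨ ^-congʳ z (≡.trans (≡.cong suc (ℕ.*-comm 2 s)) (≡.sym m≡)) ⟩
          z ^ m                   ≈⟨ z^m≈1 ⟩
          1#                       ∎
          where
          z^2≈1 : z ^ 2 ≈ 1#
          z^2≈1 = trans (*-congˡ (*-identityʳ z)) (z^[P+1]≈1⇒z²≈1 z∈F (begin
            z ^ (P ℕ.+ 1)      ≈⟨ ^-congʳ z P+1≡2m ⟩
            z ^ (m ℕ.+ m)      ≈⟨ ^-homo-* z m m ⟩
            z ^ m * z ^ m     ≈⟨ *-cong z^m≈1 z^m≈1 ⟩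
            1# * 1#             ≈⟨ *-identityˡ 1# ⟩
            1#                  ∎))

        half-power-injective : InjectiveOnF (_^ m)
        half-power-injective {x} {z} x∈F z∈F eq with z ≟ 0# | x ≟ 0#
        ... | yes z≈0 | yes x≈0 = trans x≈0 (sym z≈0)
        -- Oddness makes `m` positive, so that `z ^ m` vanishes with `z`.
        ... | yes z≈0 | no  x≉0 with s , m≡ ← odd half-odd =
          contradiction (trans eq (begin
            z ^ m                       ≈⟨ ^-congʳ z m≡ ⟩
            z * z ^ (s ℕ.* 2)           ≈⟨ *-congʳ z≈0 ⟩
            0# * z ^ (s ℕ.* 2)          ≈⟨ zeroˡ _ ⟩
            0#                           ∎)) (^-nonzero m x≉0)
        ... | no  z≉0 | _ with w , zw≈1 ← inverse z z≉0 = begin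
          x               ≈⟨ *-identityʳ x ⟨
          x * 1#          ≈⟨ *-congˡ zw≈1 ⟨
          x * (z * w)     ≈⟨ solve 3 (λ x z w → x :* (z :* w) := (x :* w) :* z) refl x z w ⟩
          (x * w) * z     ≈⟨ *-congʳ (half-power-kernel (*-closed x∈F (inv-closed z∈F zw≈1)) (begin
            (x * w) ^ m        ≈⟨ ^-distrib-* x w m ⟩
            x ^ m * w ^ m     ≈⟨ *-congʳ eq ⟩
            z ^ m * w ^ m     ≈⟨ ^-distrib-* z w m ⟨
            (z * w) ^ m        ≈⟨ ^-congˡ m zw≈1 ⟩
            1# ^ m             ≈⟨ 1^ m ⟩
            1#                  ∎)) ⟩
          1# * z          ≈⟨ *-identityˡ z ⟩
          z               ∎

-- The two families of functions.

module _ {q : ℕ} (E : QuadraticExtension c ℓ ℓ′ q) where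
  open QuadraticExtension E hiding (zero)
  open CommutativeSemiringExp commutativeSemiring
    using (_^_; ^-congˡ; ^-congʳ; ^-homo-*)
  open SetoidReasoning setoid
  open Subfield E
  open ONan E

  module _ {ξ : Carrier} (ξ∉F : ξ ∉ F) {α : Carrier} (α-nonsquare : Nonsquare α)
           (anisotropic : ∀ {t} → t ∈ F → t * t + α ≉ 0#) where
    open Coordinates E ξ ξ∉F using (decompose; coord₀; coord₁)

    powers-containONan : ∀ {e₀ e₁} m k → e₀ ≡ m ℕ.+ m → e₁ ≡ k ℕ.+ k →
      InjectiveOnF (_^ m) → InjectiveOnF (_^ k) →
      Unital.ContainsONan E
        (λ x → (coord₀ x ^ e₀ + α * coord₁ x ^ e₁)
                 + (1# + 1#) * coord₀ x * coord₁ x * ξ) ξ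
    powers-containONan {e₀} {e₁} m k e₀≡ e₁≡ m-injective k-injective =
      containsONan ξ∉F (proj₁ α-nonsquare) (nonsquare⇒2≉0 α-nonsquare) anisotropic
        m k m-injective k-injective decompose _ f-coordinates
      where
      square : ∀ {e} j {x y} → e ≡ j ℕ.+ j → x ≈ y → x ^ e ≈ y ^ j * y ^ j
      square {e} j {x} {y} e≡ x≈y = begin
        x ^ e              ≈⟨ ^-congˡ e x≈y ⟩
        y ^ e              ≈⟨ ^-congʳ y e≡ ⟩
        y ^ (j ℕ.+ j)      ≈⟨ ^-homo-* y j j ⟩
        y ^ j * y ^ j     ∎

      f-coordinates : ∀ {x x₀ x₁} → x₀ ∈ F → x₁ ∈ F → x ≈ x₀ + x₁ * ξ →
        (coord₀ x ^ e₀ + α * coord₁ x ^ e₁) + (1# + 1#) * coord₀ x * coord₁ x * ξ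
        ≈ (x₀ ^ m * x₀ ^ m + α * (x₁ ^ k * x₁ ^ k)) + (1# + 1#) * x₀ * x₁ * ξ
      f-coordinates {x} x₀∈F x₁∈F x≈ =
        let _ , _ , y₀∈F , y₁∈F , x≈′ = decompose x
            y₀≈ , y₁≈ = coordinates-unique ξ∉F y₀∈F y₁∈F x₀∈F x₁∈F (trans (sym x≈′) x≈)
        in +-cong (+-cong (square m e₀≡ y₀≈) (*-congˡ (square k e₁≡ y₁≈)))
                  (*-congʳ (*-cong (*-congˡ y₀≈) y₁≈))

open import Data.Nat.Base using (_<_; _^_; _%_)

-- The halved exponents are `1` and `p ^ i` for `f₁`. For `f₂` they are `m = (p ^ k + 1) / 2` and
-- `p ^ i * m`, because `p ^ (k + i) + p ^ i = p ^ i * (p ^ k + 1)`.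
f₁-f₂-containONan : ∀ {p n q : ℕ} → ¬ 2 ∣ p → q ≡ p ^ n → q % 4 ≡ 1 →
  (E : QuadraticExtension c ℓ ℓ′ q) →
  let open QuadraticExtension E in
  (ξ : Carrier) (ξ∉F : ξ ∉ F) (α : Carrier) → Nonsquare α →
  let open Functions E p ξ ξ∉F α in
  (∀ i → i < n → Unital.ContainsONan E (f₁ i) ξ) ×
  (∀ i k → i < n → ¬ 2 ∣ quotient (gcd[m,n]∣n k n) → Unital.ContainsONan E (f₂ k i) ξ)
f₁-f₂-containONan {p = p} {n} {suc q} 2∤p q≡p^n q≡1 E ξ ξ∉F α α-nonsquare =
  (λ i i<n → powers-containONan E ξ∉F α-nonsquare α-anisotropic 1 (p ^ i)
    ≡.refl (≡.cong (p ^ i ℕ.+_) (ℕ.+-identityʳ (p ^ i)))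
    (λ {x} {y} _ _ eq → trans (sym (*-identityʳ x)) (trans eq (*-identityʳ y)))
    (frobenius-injective i<n)) ,
  λ i k i<n 2∤n/gcd →
    let m , P+1≡2m = half-successor 2∤p k in
    powers-containONan E ξ∉F α-nonsquare α-anisotropic m (p ^ i ℕ.* m)
      P+1≡2m (exponent i k m P+1≡2m)
      (half-power-injective y∈F y²≈-1 2≉0 k 2∤n/gcd m P+1≡2m)
      (^-injective-∘ (p ^ i) m (frobenius-injective i<n)
        (half-power-injective y∈F y²≈-1 2≉0 k 2∤n/gcd m P+1≡2m))
  where
  open QuadraticExtension E using (trans; sym; *-identityʳ)
  open Subfield E
  open Units E
  open PowerMaps E {p} {n} q≡p^n

  -- The order `suc q` of `F` leaves remainder 1, so the number `q` of units is divisible by 4.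
  q≡4m : q ≡ suc q ℕ./ 4 ℕ.* 4
  q≡4m = ℕ.suc-injective (≡.trans (m≡m%n+[m/n]*n (suc q) 4)
    (≡.cong (ℕ._+ suc q ℕ./ 4 ℕ.* 4) q≡1))

  root = √-1 (suc q ℕ./ 4) q≡4m
  y∈F = proj₁ (proj₂ root)
  y²≈-1 = proj₂ (proj₂ root)
  2≉0 = nonsquare⇒2≉0 α-nonsquare
  α-anisotropic = λ {t} → anisotropic y∈F y²≈-1 α-nonsquare {t}

  exponent : ∀ i k m → p ^ k ℕ.+ 1 ≡ m ℕ.+ m →
             p ^ (k ℕ.+ i) ℕ.+ p ^ i ≡ p ^ i ℕ.* m ℕ.+ p ^ i ℕ.* m
  exponent i k m eq = begin
    p ^ (k ℕ.+ i) ℕ.+ p ^ i              ≡⟨ ≡.cong (ℕ._+ p ^ i) (ℕ.^-distribˡ-+-* p k i) ⟩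
    p ^ k ℕ.* p ^ i ℕ.+ p ^ i            ≡⟨ solve 2 (λ a b → a :* b :+ b := b :* (a :+ con 1))
                                                ≡.refl (p ^ k) (p ^ i) ⟩
    p ^ i ℕ.* (p ^ k ℕ.+ 1)              ≡⟨ ≡.cong (p ^ i ℕ.*_) eq ⟩
    p ^ i ℕ.* (m ℕ.+ m)                  ≡⟨ ℕ.*-distribˡ-+ (p ^ i) m m ⟩
    p ^ i ℕ.* m ℕ.+ p ^ i ℕ.* m          ∎
    where
    open ≡.≡-Reasoning
    open +-*-Solver

theorem3p15 : ∀ {c ℓ ℓ′} (p n : ℕ) → Prime p → p ≢ 2 → 0 < n → (p ^ n) % 4 ≡ 1 →
    (E : QuadraticExtension c ℓ ℓ′ (p ^ n)) →
    let open QuadraticExtension E in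
    (ξ : Carrier) (ξ∉F : ξ ∉ F) (α : Carrier) → Nonsquare α →
    (ω : Carrier) → ω ∈ F → ω * ω - ω + 1# ≈ 0# →
    let open Functions E p ξ ξ∉F α in
    (∀ i → 0 < i → i < n → Unital.ContainsONan E (f₁ i) ξ)
    ×
    (∀ i k → 0 < i → i < n → 0 < k → k < n →
    ¬ (2 ∣ quotient (gcd[m,n]∣n k n)) →
    Unital.ContainsONan E (f₂ k i) ξ)
theorem3p15 p n p-prime p≢2 _ q≡1 E ξ ξ∉F α α-nonsquare _ _ _ =
  (λ i _ → proj₁ both i) , (λ i k _ i<n _ _ → proj₂ both i k i<n)
  where
  both = f₁-f₂-containONan (odd-prime p-prime p≢2) ≡.refl q≡1 E ξ ξ∉F α α-nonsquare
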